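{- There is a universal constant $C>0$ such that the following holds. Let $\mathrm{alg}$ be a randomized algorithm with running time $X$, profile $(1/\beta,\nabla)$, and optimal expected simulation time $\mathcal{O}$, where $2\le\mathcal{O}<\infty$. Let $T$ be the total running time of the wide search simulation of $\mathrm{alg}$, in which the $i$-th copy is run at speed $\alpha_i=1/i$. Then $$\mathbb{E}[T]\le C\,\frac{\nabla}{\beta}\log\frac{\nabla}{\beta}\qquad\text{and}\qquad \mathbb{E}[T]\le C\,\mathcal{O}\log\mathcal{O}.$$
   Context: A randomized (Las Vegas) algorithm $\mathrm{alg}$ is represented by its running time $X$, a random variable with values in $[1,+\infty]$ (one second is the minimal running time; the value $+\infty$ means that the run never stops) with $\mathbb{P}[X<\infty]>0$. Different copies of $\mathrm{alg}$ use independent randomness, so their running times are independent copies of $X$. $\mathcal{O}$ denotes the optimal (minimal) expected running time of any simulation of $\mathrm{alg}$ (rerunning $\mathrm{alg}$ with time thresholds until some run stops within its threshold). It is attained by repeating one fixed threshold, so that $\mathcal{O}=\inf_{t} f(t)$, where $f(t)=\mathbb{E}[X\mid X\le t]+\frac{\mathbb{P}[X>t]}{\mathbb{P}[X\le t]}\,t$ and $t$ ranges over positive thresholds with $\mathbb{P}[X\le t]>0$. Profile: let $R(\alpha)=\alpha/\mathbb{P}[X\le\alpha]$ for $\alpha>0$ (with value $+\infty$ if $\mathbb{P}[X\le\alpha]=0$), and let $\nabla=\arg\min_{\alpha>0}R(\alpha)$ (any minimizer). The profile of $\mathrm{alg}$ is $(1/\beta,\nabla)$, where $\beta=\mathbb{P}[X\le\nabla]$.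 Wide search: independent copies $A_1,A_2,\dots$ of $\mathrm{alg}$ are run with pausing and resuming, $A_i$ at speed $\alpha_i=1/i$. At simulation time $t=1,2,3,\dots$ (the number of seconds $A_1$ has run), copy $A_i$ has been run for a total of $n_i(t)=\lfloor t/i\rfloor$ seconds; that is, whenever $n_j(t)$ increases to a new integer value, $A_j$ is resumed (or started) and run for one more second. The simulation stops as soon as some copy terminates naturally. Its total running time $T$ is the total number of seconds spent running all copies until then (the overhead of the simulation itself is ignored). -}

module Defs where

open import Level using (Level; Setω; 0ℓ) renaming (suc to lsuc)
open import Algebra.Bundles using (CommutativeRing; Semiring)
open import Algebra.Structures using (IsCommutativeRing)
import Algebra.Definitions.RawSemiring
open import Axiom.ExcludedMiddle using (ExcludedMiddle)
open import Data.Bool.Base using (if_then_else_)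
open import Data.Fin.Base using (Fin; toℕ)
open import Data.List.Base using (map; upTo)
open import Data.Maybe.Base using (fromMaybe) renaming (map to map⁺)
open import Data.Nat.Base as ℕ using (ℕ; suc)
open import Data.Nat.DivMod using () renaming (_/_ to _div_)
open import Data.Nat.ListAction using () renaming (sum to sumℕ)
open import Data.Product.Base using (Σ; ∃; ∃-syntax; _×_; _,_; proj₁)
open import Relation.Binary.PropositionalEquality.Core using (_≡_; _≢_)
open import Relation.Binary.Structures using (IsTotalOrder)
import Relation.Binary.Construct.Add.Supremum.NonStrict as AddSup
import Relation.Binary.Construct.NonStrictToStrict as ToStrict
open import Relation.Nullary.Construct.Add.Supremum using (_⁺; [_]; ⊤⁺)
open import Relation.Nullary.Decidable.Core using (does; yes; no)
open import Relation.Nullary.Negation.Core using (¬_)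
open import Relation.Unary using (Pred; ∁; U; ⋃; ⋂; _≐_; _⊥_; _⊢_; Satisfiable)

-- Axiomatisation of the real numbers: a Dedekind-complete totally ordered
-- field (unique up to isomorphism).
record Reals : Setω where
  infixl 6 _+_ _-_
  infixl 7 _*_ _/_
  infix  8 -_
  infix  9 _⁻¹
  infix  4 _≤_
  field
    ℝ       : Set
    _+_ _*_ : ℝ → ℝ → ℝ
    -_      : ℝ → ℝ
    0# 1#   : ℝ
    _≤_     : ℝ → ℝ → Set
    -- The value of 0# ⁻¹ is unconstrained.
    _⁻¹     : ℝ → ℝ

    isCommutativeRing : IsCommutativeRing _≡_ _+_ _*_ -_ 0# 1#
    0#≢1#             : 0# ≢ 1#
    *-inverseʳ        : ∀ x → x ≢ 0# → x * x ⁻¹ ≡ 1#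

    isTotalOrder : IsTotalOrder _≡_ _≤_
    +-monoˡ-≤    : ∀ z {x y} → x ≤ y → x + z ≤ y + z
    *-nonNeg     : ∀ {x y} → 0# ≤ x → 0# ≤ y → 0# ≤ x * y

  IsUpperBound : ∀ {ℓ : Level} → Pred ℝ ℓ → ℝ → Set ℓ
  IsUpperBound P u = ∀ x → P x → x ≤ u

  IsSupremum : ∀ {ℓ : Level} → Pred ℝ ℓ → ℝ → Set ℓ
  IsSupremum P s = IsUpperBound P s × (∀ u → IsUpperBound P u → s ≤ u)

  field
    complete : ∀ {ℓ : Level} (P : Pred ℝ ℓ) →
               ∃⟨ P ⟩ → ∃⟨ IsUpperBound P ⟩ → ∃⟨ IsSupremum P ⟩

  commutativeRing : CommutativeRing 0ℓ 0ℓ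
  commutativeRing = record { isCommutativeRing = isCommutativeRing }

  open Algebra.Definitions.RawSemiring (Semiring.rawSemiring (CommutativeRing.semiring commutativeRing)) public
    using (sum; product; _^_) renaming (_×_ to _·_)

  open ToStrict _≡_ _≤_ public using (_<_)
  open AddSup _≤_ public using (_≤⁺_)

  _-_ _/_ : ℝ → ℝ → ℝ
  x - y = x + (- y)
  x / y = x * y ⁻¹

  fromℕ : ℕ → ℝ
  fromℕ n = n · 1#

-- The extended reals (-∞ , +∞] are ℝ ⁺, with +∞ written ⊤⁺.
module Theory (em : ∀ {ℓ : Level} → ExcludedMiddle ℓ) (reals : Reals) where

  open Reals reals

  -- Supremum in (-∞ , +∞] of a nonempty set of reals.  (The value ⊤⁺ on the
  -- empty set is never used.)
  sup⁺ : ∀ {ℓ : Level} → Pred ℝ ℓ → ℝ ⁺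
  sup⁺ P with em {P = ∃⟨ P ⟩ × ∃⟨ IsUpperBound P ⟩}
  ... | yes (inhabited , bounded) = [ proj₁ (complete P inhabited bounded) ]
  ... | no _                      = ⊤⁺

  -- Infimum, as the supremum of the real lower bounds; inf⁺ ∅ = +∞.  The sets
  -- to which it is applied lie in [0 , +∞].
  inf⁺ : ∀ {ℓ : Level} → Pred (ℝ ⁺) ℓ → ℝ ⁺
  inf⁺ P = sup⁺ λ l → ∀ y → P y → [ l ] ≤⁺ y

  -- For x > 0, the logarithm to base 2: the supremum of the rationals r with
  -- 2 ^ r ≤ x, where r = (m - n) / (1 + q).  The default 0# is returned only
  -- for x ≤ 0.
  log : ℝ → ℝ
  log x = fromMaybe 0# (sup⁺ λ r →
    ∃[ m ] ∃[ n ] ∃[ q ]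
      (r ≡ (fromℕ m - fromℕ n) / fromℕ (suc q)) ×
      ((1# + 1#) ^ m ≤ (1# + 1#) ^ n * x ^ suc q))

  record ProbabilitySpace : Set₂ where
    field
      Ω          : Set
      Measurable : Pred Ω 0ℓ → Set₁
      -- Only the values of ℙ on measurable sets are meaningful.
      ℙ          : Pred Ω 0ℓ → ℝ

      U-measurable : Measurable U
      ∁-measurable : ∀ A → Measurable A → Measurable (∁ A)
      ⋃-measurable : ∀ (A : ℕ → Pred Ω 0ℓ) → (∀ n → Measurable (A n)) →
                     Measurable (⋃[ n ∶ ℕ ] A n)
      ≐-measurable : ∀ {A B} → A ≐ B → Measurable A → Measurable B

      ℙ-cong      : ∀ {A B} → A ≐ B → Measurable A → ℙ A ≡ ℙ B
      ℙ-nonNeg    : ∀ {A} → Measurable A → 0# ≤ ℙ A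
      ℙ-U         : ℙ U ≡ 1#
      -- A series of nonnegative terms is the supremum of its partial sums.
      ℙ-σ-additive : ∀ (A : ℕ → Pred Ω 0ℓ) → (∀ n → Measurable (A n)) →
                     (∀ {m n} → m ≢ n → A m ⊥ A n) →
                     IsSupremum
                       (λ x → ∃[ n ] x ≡ sum {n} (λ i → ℙ (A (toℕ i))))
                       (ℙ (⋃[ n ∶ ℕ ] A n))

    -- The integrals of the nonnegative simple functions below Y.
    SimpleIntegral : (Ω → ℝ ⁺) → Pred ℝ (lsuc 0ℓ)
    SimpleIntegral Y x =
      Σ ℕ λ n → Σ (Fin n → Pred Ω 0ℓ) λ A → Σ (Fin n → ℝ) λ c →
        (∀ i → Measurable (A i)) ×
        (∀ {i j} → i ≢ j → A i ⊥ A j) ×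
        (∀ i → 0# ≤ c i) ×
        (∀ i ω → A i ω → [ c i ] ≤⁺ Y ω) ×
        (x ≡ sum (λ i → c i * ℙ (A i)))

    -- The Lebesgue integral of a measurable Y with values in [0 , +∞].
    𝔼 : (Ω → ℝ ⁺) → ℝ ⁺
    𝔼 Y = sup⁺ (SimpleIntegral Y)

    restrict : Pred Ω 0ℓ → (Ω → ℝ ⁺) → (Ω → ℝ ⁺)
    restrict A Y ω = if does (em {P = A ω}) then Y ω else [ 0# ]

    𝔼[_∣_] : (Ω → ℝ ⁺) → Pred Ω 0ℓ → ℝ ⁺
    𝔼[ Y ∣ A ] = map⁺ (_/ ℙ A) (𝔼 (restrict A Y))

  data Borel : Pred (ℝ ⁺) 0ℓ → Set₁ where
    ray-borel : ∀ a → Borel (_≤⁺ [ a ])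
    ∁-borel   : ∀ {B} → Borel B → Borel (∁ B)
    ⋃-borel   : ∀ (B : ℕ → Pred (ℝ ⁺) 0ℓ) → (∀ n → Borel (B n)) →
                Borel (⋃[ n ∶ ℕ ] B n)
    ≐-borel   : ∀ {B C} → B ≐ C → Borel B → Borel C

  record Algorithm : Set₂ where
    field
      space : ProbabilitySpace
    open ProbabilitySpace space public
    field
      X            : Ω → ℝ ⁺
      X-measurable : ∀ B → Borel B → Measurable (X ⊢ B)
      1≤X          : ∀ ω → [ 1# ] ≤⁺ X ω
      X-finite     : 0# < ℙ (λ ω → X ω ≢ ⊤⁺)

    ℙ[X≤_] ℙ[X>_] : ℝ → ℝ
    ℙ[X≤ t ] = ℙ (λ ω → X ω ≤⁺ [ t ])
    ℙ[X> t ] = ℙ (λ ω → ¬ (X ω ≤⁺ [ t ]))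

    -- Expected time of the simulation repeating the threshold t.
    f : ℝ → ℝ ⁺
    f t = map⁺ (_+ (ℙ[X> t ] / ℙ[X≤ t ]) * t) 𝔼[ X ∣ (λ ω → X ω ≤⁺ [ t ]) ]

    𝒪 : ℝ ⁺
    𝒪 = inf⁺ λ y → ∃[ t ] (0# < t) × (0# < ℙ[X≤ t ]) × (y ≡ f t)

    R : ℝ → ℝ ⁺
    R α = if does (em {P = ℙ[X≤ α ] ≡ 0#}) then ⊤⁺ else [ α / ℙ[X≤ α ] ]

    IsArgminR : ℝ → Set
    IsArgminR ∇ = (0# < ∇) × (∀ α → 0# < α → R ∇ ≤⁺ R α)

  -- Number of full seconds that copy i has been allotted by simulation time t.
  -- Copies are indexed from 0 here: index i is the (1 + i)-th copy, which runs
  -- at speed 1 / (1 + i).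
  allotted : ℕ → ℕ → ℕ
  allotted i t = t div suc i

  -- During the step from simulation time s to 1 + s, the copies that are due
  -- for another second are run in order of increasing index.  This is the total
  -- time received by all copies other than j when it is the turn of copy j: the
  -- copies before j have completed step 1 + s, those after j only step s.
  -- (Copies with index at least s have been allotted nothing by time s, so
  -- the second sum covers all of the latter.)
  othersTime : ℕ → ℕ → ℕ
  othersTime j s =
    sumℕ (map (λ i → allotted i (suc s)) (upTo j)) ℕ.+
    sumℕ (map (λ k → allotted (suc j ℕ.+ k) s) (upTo s))

  record Copies (alg : Algorithm) : Set₂ where
    private module alg = Algorithm alg
    field
      space : ProbabilitySpace
    open ProbabilitySpace space public
    field
      A            : ℕ → Ω → ℝ ⁺
      A-measurable : ∀ i B → Borel B → Measurable (A i ⊢ B)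
      1≤A          : ∀ i ω → [ 1# ] ≤⁺ A i ω
      A-law        : ∀ i B → Borel B → ℙ (A i ⊢ B) ≡ alg.ℙ (alg.X ⊢ B)
      A-independent : ∀ n (B : Fin n → Pred (ℝ ⁺) 0ℓ) → (∀ i → Borel (B i)) →
                      ℙ (⋂[ i ∶ Fin n ] (A (toℕ i) ⊢ B i))
                        ≡ product (λ i → ℙ (A (toℕ i) ⊢ B i))

    -- Copy j terminates naturally in the step from simulation time s to 1 + s.
    TerminatesIn : ℕ → ℕ → Pred Ω 0ℓ
    TerminatesIn j s ω =
      ¬ (A j ω ≤⁺ [ fromℕ (allotted j s) ]) ×
      (A j ω ≤⁺ [ fromℕ (allotted j (suc s)) ])

    -- Total running time of the wide search.  The set consists of the elapsed
    -- times, in the schedule run without stopping, at which the copies terminate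
    -- naturally: copy j has then itself run for exactly A j ω seconds (its last
    -- second may be incomplete).  The search stops at the earliest of these, and
    -- never if there is none.
    T : Ω → ℝ ⁺
    T ω = inf⁺ λ y → ∃[ j ] ∃[ s ]
      TerminatesIn j s ω × (y ≡ map⁺ (_+ fromℕ (othersTime j s)) (A j ω))

{-# OPTIONS --safe #-}

-- Write M = ∇ / β and 2 ^ L ≤ M < 2 ^ (1 + L).  If copy k (from 0) is the first one that needs at most
-- ∇ seconds, the search stops by simulation time t = ⌈∇⌉ (1 + k), and the harmonic sum bounds the total
-- time by t (1 + L) + t² / 2 ^ L.  The index k is geometric with parameter β, so the moments of t give
-- 𝔼 T = O (M L); instead of summing series, the moments are controlled by a quadratic potential in k.
-- Minimality of R at ∇ means M ℙ[X ≤ t] ≤ t for all t, from which 𝒪 ≤ M ≤ 4 𝒪.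

module Submission where

open import Defs
open import Level using (Level; 0ℓ)
open import Algebra.Bundles using (CommutativeRing)
import Algebra.Properties.Ring
import Algebra.Properties.Semiring.Exp
import Algebra.Properties.Semiring.Mult
open import Algebra.Properties.Semiring.Mult.TCOptimised using (×ᵤ≈×)
import Algebra.Properties.Semiring.Sum
import Algebra.Solver.Ring.NaturalCoefficients.Default
open import Axiom.DoubleNegationElimination using (em⇒dne)
open import Axiom.ExcludedMiddle using (ExcludedMiddle)
open import Data.Empty using (⊥-elim)
open import Data.Fin.Base as Fin using (Fin; toℕ; fromℕ<)
import Data.Fin.Properties as Finₚ
open import Data.List.Base using (applyUpTo; upTo; map)
open import Data.List.Properties using (map-upTo)
open import Data.Maybe.Base using (fromMaybe) renaming (map to map⁺)
open import Data.Nat.Base as ℕ using (ℕ; zero; suc; s≤s; s≤s⁻¹; z≤n)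
open import Data.Nat.DivMod using (m/n*n≤m; m<n⇒m/n≡0; n/1≡n; /-monoˡ-≤; m*n/n≡m; 0/n≡0)
  renaming (_/_ to _div_)
open import Data.Nat.ListAction using () renaming (sum to sumℕ)
import Data.Nat.Properties as ℕₚ
open import Data.Product.Base using (∃-syntax; _×_; _,_; proj₁; proj₂)
open import Data.Sum.Base using (inj₁; inj₂)
open import Data.Unit.Base using (tt)
open import Function.Base using (_∘_)
open import Relation.Binary.Bundles using (Poset)
import Relation.Binary.Construct.Add.Supremum.NonStrict as AddSup
open import Relation.Binary.PropositionalEquality
  using (_≡_; _≢_; refl; sym; trans; cong; cong₂; subst; subst₂)
import Relation.Binary.Reasoning.PartialOrder
open import Relation.Binary.Structures using (IsTotalOrder)
open import Relation.Nullary.Construct.Add.Supremum using (_⁺; [_]; ⊤⁺)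
open import Relation.Nullary.Decidable.Core using (yes; no)
open import Relation.Nullary.Negation.Core using (¬_)
open import Relation.Unary using (Pred; ∁; U; _∩_; _∪_; ∅; ⋃; ⋂; _≐_; _⊥_; _⊆_; _⊢_; Satisfiable)

-- The harmonic sum is cut at a fixed index near M, not at the random time t. A cut at t would give
-- t log t, whose expectation is no polynomial moment; the cut at `2 ^ L` leaves a quadratic
-- polynomial in t. As 𝔼 t is of order M and 𝔼 t² of order M², the tail t² / `2 ^ L` then costs only
-- O(M). Since `𝔼` is a supremum over simple functions, each of them is bounded separately. A simple
-- function has a largest value, so whatever it still carries after many failures is absorbed by a
-- potential that grows without bound. Logarithms are reached only through the integer exponents of
-- dyadic brackets. The inequality 𝒪 ≤ M ensures L ≥ 1, and M ≤ 4𝒪 compares L with the exponent L′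
-- of 𝒪. The constant is 240 = 20 · 4 · 3: the initial potential is at most 20 M L, then M ≤ 4𝒪, and
-- L ≤ L′ + 2 ≤ 3 L′.

module HarmonicSums where
  open import Data.Nat.Base using (_+_; _*_; _^_; _≤_; _<_)

  -- Dyadic bounds for harmonic sums of integer quotients

  sum-applyUpTo-+ : ∀ (f : ℕ → ℕ) m n →
    sumℕ (applyUpTo f (m + n)) ≡ sumℕ (applyUpTo f m) + sumℕ (applyUpTo (f ∘ (m +_)) n)
  sum-applyUpTo-+ f zero    n = refl
  sum-applyUpTo-+ f (suc m) n =
    trans (cong (f 0 +_) (sum-applyUpTo-+ (f ∘ suc) m n)) (sym (ℕₚ.+-assoc (f 0) _ _))

  sum-applyUpTo-mono : ∀ {f g : ℕ → ℕ} → (∀ i → f i ≤ g i) → ∀ n →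
    sumℕ (applyUpTo f n) ≤ sumℕ (applyUpTo g n)
  sum-applyUpTo-mono f≤g zero    = z≤n
  sum-applyUpTo-mono f≤g (suc n) = ℕₚ.+-mono-≤ (f≤g 0) (sum-applyUpTo-mono (f≤g ∘ suc) n)

  -- At most t terms are nonzero, and each is at most a / d; the factor d is kept on the left so
  -- that everything stays in ℕ.
  *-sum-applyUpTo-≤ : ∀ {f : ℕ → ℕ} {a} d t n → (∀ i → d * f i ≤ a) →
    (∀ i → t ≤ i → i < n → f i ≡ 0) → d * sumℕ (applyUpTo f n) ≤ t * a
  *-sum-applyUpTo-≤ d t zero f≤a vanish rewrite ℕₚ.*-zeroʳ d = z≤n
  *-sum-applyUpTo-≤ {f} d zero (suc n) f≤a vanish
    rewrite vanish 0 z≤n (s≤s z≤n) =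
      *-sum-applyUpTo-≤ d 0 n (f≤a ∘ suc) (λ i _ i<n → vanish (suc i) z≤n (s≤s i<n))
  *-sum-applyUpTo-≤ {f} {a} d (suc t) (suc n) f≤a vanish = begin
    d * (f 0 + sumℕ (applyUpTo (f ∘ suc) n))     ≡⟨ ℕₚ.*-distribˡ-+ d (f 0) _ ⟩
    d * f 0 + d * sumℕ (applyUpTo (f ∘ suc) n)   ≤⟨ ℕₚ.+-mono-≤ (f≤a 0)
      (*-sum-applyUpTo-≤ d t n (f≤a ∘ suc) (λ i t≤i i<n → vanish (suc i) (s≤s t≤i) (s≤s i<n))) ⟩
    a + t * a ∎
    where open ℕₚ.≤-Reasoning

  *-div-suc-≤ : ∀ d t i → d * (t div suc (d + i)) ≤ t
  *-div-suc-≤ d t i = begin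
    d * (t div suc (d + i))             ≤⟨ ℕₚ.*-monoˡ-≤ _ (ℕₚ.m≤n⇒m≤1+n (ℕₚ.m≤m+n d i)) ⟩
    suc (d + i) * (t div suc (d + i))   ≡⟨ ℕₚ.*-comm (suc (d + i)) _ ⟩
    (t div suc (d + i)) * suc (d + i)   ≤⟨ m/n*n≤m t (suc (d + i)) ⟩
    t ∎
    where open ℕₚ.≤-Reasoning

  -- The block of indices from 2 ^ l to 2 ^ (1 + l) has 2 ^ l terms of size at most t / 2 ^ l, so
  -- each doubling of the range adds at most t.
  harmonic-dyadic : ∀ t l → sumℕ (applyUpTo (λ i → t div suc i) (2 ^ l)) ≤ t * suc l
  harmonic-dyadic t zero =
    ℕₚ.≤-reflexive (trans (ℕₚ.+-identityʳ _) (trans (n/1≡n t) (sym (ℕₚ.*-identityʳ t))))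
  harmonic-dyadic t (suc l) = begin
    sumℕ (applyUpTo f (D + (D + 0)))  ≡⟨ sum-applyUpTo-+ f D (D + 0) ⟩
    sumℕ (applyUpTo f D) + sumℕ (applyUpTo (f ∘ (D +_)) (D + 0))
      ≤⟨ ℕₚ.+-mono-≤ (harmonic-dyadic t l) (ℕₚ.*-cancelˡ-≤ D {{ℕₚ.m^n≢0 2 l}} block) ⟩
    t * suc l + t                     ≡⟨ ℕₚ.+-comm (t * suc l) t ⟩
    t + t * suc l                     ≡⟨ ℕₚ.*-suc t (suc l) ⟨
    t * suc (suc l) ∎
    where
    open ℕₚ.≤-Reasoning
    f = λ i → t div suc i
    D = 2 ^ l
    block : D * sumℕ (applyUpTo (f ∘ (D +_)) (D + 0)) ≤ D * t
    block rewrite ℕₚ.+-identityʳ D =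
      *-sum-applyUpTo-≤ D D D (*-div-suc-≤ D t) (λ i D≤i i<D → ⊥-elim (ℕₚ.<⇒≱ i<D D≤i))

  harmonic-≤ : ∀ t l n → 2 ^ l * sumℕ (applyUpTo (λ i → t div suc i) n) ≤ 2 ^ l * (t * suc l) + t * t
  harmonic-≤ t l n = begin
    D * sumℕ (applyUpTo f n)        ≤⟨ ℕₚ.*-monoʳ-≤ D extend ⟩
    D * sumℕ (applyUpTo f (D + n))  ≡⟨ cong (D *_) (sum-applyUpTo-+ f D n) ⟩
    D * (sumℕ (applyUpTo f D) + sumℕ (applyUpTo (f ∘ (D +_)) n)) ≡⟨ ℕₚ.*-distribˡ-+ D _ _ ⟩
    D * sumℕ (applyUpTo f D) + D * sumℕ (applyUpTo (f ∘ (D +_)) n)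
      ≤⟨ ℕₚ.+-mono-≤ (ℕₚ.*-monoʳ-≤ D (harmonic-dyadic t l))
           (*-sum-applyUpTo-≤ D t n (*-div-suc-≤ D t)
             (λ i t≤i _ → m<n⇒m/n≡0 (s≤s (ℕₚ.≤-trans t≤i (ℕₚ.m≤n+m i D))))) ⟩
    D * (t * suc l) + t * t ∎
    where
    open ℕₚ.≤-Reasoning
    f = λ i → t div suc i
    D = 2 ^ l
    -- As n may be smaller than D, the sum is padded before it is split at D. Past D every term is
    -- at most t / D, and the terms with index at least t vanish.
    extend : sumℕ (applyUpTo f n) ≤ sumℕ (applyUpTo f (D + n))
    extend = begin
      sumℕ (applyUpTo f n)        ≤⟨ ℕₚ.m≤m+n _ _ ⟩
      sumℕ (applyUpTo f n) + sumℕ (applyUpTo (f ∘ (n +_)) D) ≡⟨ sum-applyUpTo-+ f n D ⟨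
      sumℕ (applyUpTo f (n + D))  ≡⟨ cong (sumℕ ∘ applyUpTo f) (ℕₚ.+-comm n D) ⟩
      sumℕ (applyUpTo f (D + n)) ∎

module WideSearch (em : ∀ {ℓ : Level} → ExcludedMiddle ℓ) (reals : Reals) where

  open Theory em reals

  -- Total time of the schedule up to a given step

  module Schedule where
    open import Data.Nat.Base using (_+_; _*_; _^_; _≤_)
    open HarmonicSums

    -- Copies after j have received only their share of step s; granting them step `suc s` too turns
    -- the elapsed time into a plain harmonic sum at time `suc s`, over j earlier copies, copy j and
    -- s later ones.
    elapsed-≤ : ∀ j s → allotted j (suc s) + othersTime j s
      ≤ sumℕ (applyUpTo (λ i → suc s div suc i) (j + suc s))
    elapsed-≤ j s = begin
      f j + (sumℕ (map f (upTo j)) + sumℕ (map (λ k → s div suc (suc j + k)) (upTo s)))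
        ≡⟨ cong₂ (λ x y → f j + (sumℕ x + sumℕ y)) (map-upTo f j) (map-upTo _ s) ⟩
      f j + (sumℕ (applyUpTo f j) + sumℕ (applyUpTo (λ k → s div suc (suc j + k)) s))
        ≤⟨ ℕₚ.+-mono-≤ (ℕₚ.≤-reflexive (cong f (sym (ℕₚ.+-identityʳ j))))
             (ℕₚ.+-monoʳ-≤ (sumℕ (applyUpTo f j)) (sum-applyUpTo-mono step s)) ⟩
      f (j + 0) + (sumℕ (applyUpTo f j) + sumℕ (applyUpTo (λ k → f (j + suc k)) s))
        ≡⟨ ℕₚ.+-assoc (f (j + 0)) _ _ ⟨
      (f (j + 0) + sumℕ (applyUpTo f j)) + sumℕ (applyUpTo (λ k → f (j + suc k)) s)
        ≡⟨ cong (_+ sumℕ (applyUpTo (λ k → f (j + suc k)) s)) (ℕₚ.+-comm (f (j + 0)) _) ⟩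
      (sumℕ (applyUpTo f j) + f (j + 0)) + sumℕ (applyUpTo (λ k → f (j + suc k)) s)
        ≡⟨ ℕₚ.+-assoc (sumℕ (applyUpTo f j)) _ _ ⟩
      sumℕ (applyUpTo f j) + sumℕ (applyUpTo (λ k → f (j + k)) (suc s))
        ≡⟨ sum-applyUpTo-+ f j (suc s) ⟨
      sumℕ (applyUpTo f (j + suc s)) ∎
      where
      open ℕₚ.≤-Reasoning
      f = λ i → suc s div suc i
      step : ∀ k → s div suc (suc j + k) ≤ f (j + suc k)
      step k rewrite ℕₚ.+-suc j k = /-monoˡ-≤ (suc (suc (j + k))) (ℕₚ.n≤1+n s)

    total-time-≤ : ∀ l n j s → suc s ≤ n →
      2 ^ l * (allotted j (suc s) + othersTime j s) ≤ 2 ^ l * (n * suc l) + n * n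
    total-time-≤ l n j s s<n = begin
      2 ^ l * (allotted j (suc s) + othersTime j s) ≤⟨ ℕₚ.*-monoʳ-≤ (2 ^ l) (elapsed-≤ j s) ⟩
      2 ^ l * sumℕ (applyUpTo (λ i → suc s div suc i) (j + suc s)) ≤⟨ harmonic-≤ (suc s) l (j + suc s) ⟩
      2 ^ l * (suc s * suc l) + suc s * suc s
        ≤⟨ ℕₚ.+-mono-≤ (ℕₚ.*-monoʳ-≤ (2 ^ l) (ℕₚ.*-monoˡ-≤ (suc l) s<n)) (ℕₚ.*-mono-≤ s<n s<n) ⟩
      2 ^ l * (n * suc l) + n * n ∎
      where open ℕₚ.≤-Reasoning

  open Schedule
  open Reals reals
  open AddSup _≤_ using ([_]; _≤⊤⁺)

  -- Ordered field arithmetic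

  open CommutativeRing commutativeRing
    using (+-assoc; +-comm; +-identityˡ; +-identityʳ; *-assoc; *-comm; *-identityˡ; *-identityʳ
          ; zeroˡ; zeroʳ; distribˡ; distribʳ; -‿inverseʳ; commutativeSemiring; semiring; ring)
  open IsTotalOrder isTotalOrder
    using (antisym; total)
    renaming (refl to ≤-refl; reflexive to ≤-reflexive; trans to ≤-trans)
  open Algebra.Solver.Ring.NaturalCoefficients.Default commutativeSemiring
    using (solve; _:=_; _:+_; _:*_; con)
  open Algebra.Properties.Semiring.Mult semiring using (×-homo-+; ×1-homo-*)
  open Algebra.Properties.Semiring.Exp semiring using (^-homo-*; ^-assocʳ)
  open Algebra.Properties.Semiring.Sum semiring
    using (sum-cong-≗; ∑-distrib-+; *-distribˡ-sum; sum-replicate-zero)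

  poset : Poset 0ℓ 0ℓ 0ℓ
  poset = record { isPartialOrder = IsTotalOrder.isPartialOrder isTotalOrder }

  module ≤-Reasoning = Relation.Binary.Reasoning.PartialOrder poset
    using (begin_; step-≤; step-≡-⟩; step-≡-⟨; _∎)

  -- Descent from n to the nearest failure of P, which need not be monotone. It yields the ceiling,
  -- the dyadic bracket and the step in which a copy terminates.
  least-change : ∀ (P : ℕ → Set) → ¬ P 0 → ∀ n → P n → ∃[ m ] m ℕ.< n × ¬ P m × P (suc m)
  least-change P ¬P0 zero    P0 = ⊥-elim (¬P0 P0)
  least-change P ¬P0 (suc n) Pn with em {P = P n}
  ... | no ¬Pn = n , ℕₚ.≤-refl , ¬Pn , Pn
  ... | yes Pn′ with least-change P ¬P0 n Pn′
  ...   | m , m<n , ¬Pm , Pm+1 = m , ℕₚ.m≤n⇒m≤1+n m<n , ¬Pm , Pm+1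

  ≰⇒≥ : ∀ {x y} → ¬ (x ≤ y) → y ≤ x
  ≰⇒≥ {x} {y} x≰y with total x y
  ... | inj₁ x≤y = ⊥-elim (x≰y x≤y)
  ... | inj₂ y≤x = y≤x

  ≰⇒> : ∀ {x y} → ¬ (x ≤ y) → y < x
  ≰⇒> x≰y = ≰⇒≥ x≰y , λ { refl → x≰y ≤-refl }

  <⇒≱ : ∀ {x y} → x < y → ¬ (y ≤ x)
  <⇒≱ (x≤y , x≢y) y≤x = x≢y (antisym x≤y y≤x)

  ≮⇒≥ : ∀ {x y} → ¬ (x < y) → y ≤ x
  ≮⇒≥ {x} {y} x≮y with em {P = y ≤ x}
  ... | yes y≤x = y≤x
  ... | no y≰x  = ⊥-elim (x≮y (≰⇒> y≰x))

  +-monoʳ-≤ : ∀ z {x y} → x ≤ y → z + x ≤ z + y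
  +-monoʳ-≤ z {x} {y} x≤y = subst₂ _≤_ (+-comm x z) (+-comm y z) (+-monoˡ-≤ z x≤y)

  +-mono-≤ : ∀ {w x y z} → w ≤ x → y ≤ z → w + y ≤ x + z
  +-mono-≤ w≤x y≤z = ≤-trans (+-monoˡ-≤ _ w≤x) (+-monoʳ-≤ _ y≤z)

  x≤y⇒0≤y-x : ∀ {x y} → x ≤ y → 0# ≤ y - x
  x≤y⇒0≤y-x {x} {y} x≤y = subst (_≤ y - x) (-‿inverseʳ x) (+-monoˡ-≤ (- x) x≤y)

  x+[y-x]≡y : ∀ x y → x + (y - x) ≡ y
  x+[y-x]≡y x y = trans (cong (x +_) (+-comm y (- x)))
    (trans (sym (+-assoc x (- x) y)) (trans (cong (_+ y) (-‿inverseʳ x)) (+-identityˡ y)))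

  -- Reduces an inequality to an identity with an explicit slack d, which a solver for semirings,
  -- having no subtraction, can check.
  0≤d⇒x≤y : ∀ {x y} d → 0# ≤ d → x + d ≡ y → x ≤ y
  0≤d⇒x≤y {x} d 0≤d refl = subst (_≤ x + d) (+-identityʳ x) (+-monoʳ-≤ x 0≤d)

  +-cancelʳ-≤ : ∀ z {x y} → x + z ≤ y + z → x ≤ y
  +-cancelʳ-≤ z {x} {y} p = subst₂ _≤_ (cancel x) (cancel y) (+-monoˡ-≤ (- z) p)
    where
    cancel : ∀ w → w + z + (- z) ≡ w
    cancel w = trans (+-assoc w z (- z)) (trans (cong (w +_) (-‿inverseʳ z)) (+-identityʳ w))

  +-cancelʳ-≡ : ∀ z {x y} → x + z ≡ y + z → x ≡ y
  +-cancelʳ-≡ z p = antisym (+-cancelʳ-≤ z (≤-reflexive p)) (+-cancelʳ-≤ z (≤-reflexive (sym p)))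

  +-nonNeg : ∀ {x y} → 0# ≤ x → 0# ≤ y → 0# ≤ x + y
  +-nonNeg 0≤x 0≤y = subst (_≤ _) (+-identityˡ 0#) (+-mono-≤ 0≤x 0≤y)

  *-monoˡ-≤ : ∀ {z} → 0# ≤ z → ∀ {x y} → x ≤ y → z * x ≤ z * y
  *-monoˡ-≤ {z} 0≤z {x} {y} x≤y = 0≤d⇒x≤y (z * (y - x)) (*-nonNeg 0≤z (x≤y⇒0≤y-x x≤y))
    (trans (sym (distribˡ z x (y - x))) (cong (z *_) (x+[y-x]≡y x y)))

  *-monoʳ-≤ : ∀ {z} → 0# ≤ z → ∀ {x y} → x ≤ y → x * z ≤ y * z
  *-monoʳ-≤ {z} 0≤z {x} {y} x≤y = subst₂ _≤_ (*-comm z x) (*-comm z y) (*-monoˡ-≤ 0≤z x≤y)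

  *-mono-≤ : ∀ {w x y z} → 0# ≤ w → 0# ≤ z → w ≤ x → y ≤ z → w * y ≤ x * z
  *-mono-≤ 0≤w 0≤z w≤x y≤z = ≤-trans (*-monoˡ-≤ 0≤w y≤z) (*-monoʳ-≤ 0≤z w≤x)

  0≤1 : 0# ≤ 1#
  0≤1 with total 0# 1#
  ... | inj₁ p = p
  ... | inj₂ 1≤0 = subst (0# ≤_) (trans -x*-x≡x*x (*-identityˡ 1#)) (*-nonNeg 0≤-1 0≤-1)
    where
    open Algebra.Properties.Ring ring using (-‿distribˡ-*; -‿distribʳ-*; -‿involutive)
    0≤-1 : 0# ≤ - 1#
    0≤-1 = subst (0# ≤_) (+-identityˡ (- 1#)) (x≤y⇒0≤y-x 1≤0)
    -x*-x≡x*x : (- 1#) * (- 1#) ≡ 1# * 1#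
    -x*-x≡x*x = trans (sym (-‿distribˡ-* 1# (- 1#)))
      (trans (cong -_ (sym (-‿distribʳ-* 1# 1#))) (-‿involutive (1# * 1#)))

  0<1 : 0# < 1#
  0<1 = 0≤1 , 0#≢1#

  *-cancelˡ-≡ : ∀ {z} → z ≢ 0# → ∀ {x y} → z * x ≡ z * y → x ≡ y
  *-cancelˡ-≡ {z} z≢0 {x} {y} p = trans (sym (cancel x)) (trans (cong (z ⁻¹ *_) p) (cancel y))
    where
    cancel : ∀ w → z ⁻¹ * (z * w) ≡ w
    cancel w = trans (sym (*-assoc (z ⁻¹) z w))
      (trans (cong (_* w) (trans (*-comm (z ⁻¹) z) (*-inverseʳ z z≢0))) (*-identityˡ w))

  >⇒≢ : ∀ {x y} → x < y → y ≢ x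
  >⇒≢ x<y = proj₂ x<y ∘ sym

  *-cancelˡ-≤ : ∀ {z} → 0# < z → ∀ {x y} → z * x ≤ z * y → x ≤ y
  *-cancelˡ-≤ 0<z {x} {y} zx≤zy with total x y
  ... | inj₁ x≤y = x≤y
  ... | inj₂ y≤x = ≤-reflexive (*-cancelˡ-≡ (>⇒≢ 0<z) (antisym zx≤zy (*-monoˡ-≤ (proj₁ 0<z) y≤x)))

  *-monoˡ-< : ∀ {z x y} → 0# < z → x < y → z * x < z * y
  *-monoˡ-< 0<z (x≤y , x≢y) = *-monoˡ-≤ (proj₁ 0<z) x≤y , x≢y ∘ *-cancelˡ-≡ (>⇒≢ 0<z)

  *-pos : ∀ {x y} → 0# < x → 0# < y → 0# < x * y
  *-pos {x} {y} 0<x 0<y = subst (_< x * y) (zeroʳ x) (*-monoˡ-< 0<x 0<y)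

  <-≤-trans : ∀ {x y z} → x < y → y ≤ z → x < z
  <-≤-trans (x≤y , x≢y) y≤z = ≤-trans x≤y y≤z , λ { refl → x≢y (antisym x≤y y≤z) }

  ≤-<-trans : ∀ {x y z} → x ≤ y → y < z → x < z
  ≤-<-trans x≤y (y≤z , y≢z) = ≤-trans x≤y y≤z , λ { refl → y≢z (antisym y≤z x≤y) }

  ⁻¹-nonNeg : ∀ {x} → 0# < x → 0# ≤ x ⁻¹
  ⁻¹-nonNeg {x} 0<x = *-cancelˡ-≤ 0<x
    (subst₂ _≤_ (sym (zeroʳ x)) (sym (*-inverseʳ x (>⇒≢ 0<x))) 0≤1)

  x/y*y≡x : ∀ x {y} → y ≢ 0# → (x / y) * y ≡ x
  x/y*y≡x x {y} y≢0 = trans (*-assoc x (y ⁻¹) y)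
    (trans (cong (x *_) (trans (*-comm (y ⁻¹) y) (*-inverseʳ y y≢0))) (*-identityʳ x))

  fromℕ-+ : ∀ m n → fromℕ (m ℕ.+ n) ≡ fromℕ m + fromℕ n
  fromℕ-+ = ×-homo-+ 1#

  fromℕ-* : ∀ m n → fromℕ (m ℕ.* n) ≡ fromℕ m * fromℕ n
  fromℕ-* = ×1-homo-*

  fromℕ-nonNeg : ∀ n → 0# ≤ fromℕ n
  fromℕ-nonNeg zero    = ≤-refl
  fromℕ-nonNeg (suc n) = +-nonNeg 0≤1 (fromℕ-nonNeg n)

  fromℕ-mono-≤ : ∀ {m n} → m ℕ.≤ n → fromℕ m ≤ fromℕ n
  fromℕ-mono-≤ {n = n} z≤n = fromℕ-nonNeg n
  fromℕ-mono-≤ (s≤s p) = +-monoʳ-≤ 1# (fromℕ-mono-≤ p)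

  fromℕ-pos : ∀ n → 0# < fromℕ (suc n)
  fromℕ-pos n = <-≤-trans 0<1 (0≤d⇒x≤y (fromℕ n) (fromℕ-nonNeg n) refl)

  x<1+x : ∀ x → x < 1# + x
  x<1+x x = 0≤d⇒x≤y 1# 0≤1 (+-comm x 1#) ,
    λ x≡1+x → 0#≢1# (+-cancelʳ-≡ x (trans (+-identityˡ x) x≡1+x))

  archimedean : ∀ x → ∃[ n ] x ≤ fromℕ n
  archimedean x with em {P = ∃[ n ] x ≤ fromℕ n}
  ... | yes p = p
  ... | no ∄n = ⊥-elim (<⇒≱ (x<1+x s) (+-cancelʳ-≤ (- 1#) 1+s-1≤s-1))
    where
    isNat : ℝ → Set
    isNat y = ∃[ n ] y ≡ fromℕ n
    supremum = complete isNat (0# , 0 , refl) (x , λ { _ (n , refl) → ≰⇒≥ λ x≤n → ∄n (n , x≤n) })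
    s = proj₁ supremum
    cancel : ∀ y → 1# + y + (- 1#) ≡ y
    cancel y = trans (cong (_- 1#) (+-comm 1# y)) (trans (+-assoc y 1# (- 1#))
      (trans (cong (y +_) (-‿inverseʳ 1#)) (+-identityʳ y)))
    1+s-1≤s-1 : (1# + s) + (- 1#) ≤ s + (- 1#)
    1+s-1≤s-1 = subst (_≤ s - 1#) (sym (cancel s)) (proj₂ (proj₂ supremum) (s - 1#)
      λ { _ (n , refl) → subst (_≤ s - 1#) (cancel (fromℕ n))
        (+-monoˡ-≤ (- 1#) (proj₁ (proj₂ supremum) (fromℕ (suc n)) (suc n , refl))) })

  ceiling : ∀ {x} → 0# < x → ∃[ n ] x ≤ fromℕ n × fromℕ n ≤ 1# + x
  ceiling {x} 0<x with archimedean x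
  ... | n , x≤n with least-change (λ n → x ≤ fromℕ n) (<⇒≱ 0<x) n x≤n
  ...   | m , _ , x≰m , x≤1+m = suc m , x≤1+m , +-monoʳ-≤ 1# (≰⇒≥ x≰m)

  ^-nonNeg : ∀ {x} → 0# ≤ x → ∀ n → 0# ≤ x ^ n
  ^-nonNeg 0≤x zero    = 0≤1
  ^-nonNeg 0≤x (suc n) = *-nonNeg 0≤x (^-nonNeg 0≤x n)

  ^-monoˡ-≤ : ∀ {x y} → 0# ≤ x → x ≤ y → ∀ n → x ^ n ≤ y ^ n
  ^-monoˡ-≤ 0≤x x≤y zero    = ≤-refl
  ^-monoˡ-≤ 0≤x x≤y (suc n) = *-mono-≤ 0≤x (^-nonNeg (≤-trans 0≤x x≤y) n) x≤y (^-monoˡ-≤ 0≤x x≤y n)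

  2# : ℝ
  2# = 1# + 1#

  -- A sum nested to the left, as the solver reads `con 4`; `fromℕ 4` is nested to the right and
  -- ends in `0#`.
  4# : ℝ
  4# = 2# + 1# + 1#

  0≤2 : 0# ≤ 2#
  0≤2 = +-nonNeg 0≤1 0≤1

  0<2 : 0# < 2#
  0<2 = <-≤-trans 0<1 (0≤d⇒x≤y 1# 0≤1 refl)

  0<4 : 0# < 4#
  0<4 = <-≤-trans 0<2 (0≤d⇒x≤y 2# 0≤2 (solve 0 (con 2 :+ con 2 := con 4) refl))

  0≤4 : 0# ≤ 4#
  0≤4 = proj₁ 0<4

  2^n>0 : ∀ n → 0# < 2# ^ n
  2^n>0 zero    = 0<1
  2^n>0 (suc n) = *-pos 0<2 (2^n>0 n)

  2^n<2^[1+n] : ∀ n → 2# ^ n < 2# ^ suc n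
  2^n<2^[1+n] n = 0≤d⇒x≤y (2# ^ n) (proj₁ (2^n>0 n)) eq ,
    λ p → proj₂ (2^n>0 n) (+-cancelʳ-≡ (2# ^ n) (trans (+-identityˡ _) (trans p (sym eq))))
    where
    eq : 2# ^ n + 2# ^ n ≡ 2# * 2# ^ n
    eq = solve 1 (λ x → x :+ x := con 2 :* x) refl (2# ^ n)

  2^-mono-≤ : ∀ {m n} → m ℕ.≤ n → 2# ^ m ≤ 2# ^ n
  2^-mono-≤ p = mono (ℕₚ.≤⇒≤′ p)
    where
    mono : ∀ {m n} → m ℕ.≤′ n → 2# ^ m ≤ 2# ^ n
    mono ℕ.≤′-refl = ≤-refl
    mono {n = suc n} (ℕ.≤′-step q) = ≤-trans (mono q) (proj₁ (2^n<2^[1+n] n))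

  2^-cancel-≤ : ∀ m n → 2# ^ m ≤ 2# ^ n → m ℕ.≤ n
  2^-cancel-≤ m n p with m ℕₚ.≤? n
  ... | yes m≤n = m≤n
  ... | no m≰n = ⊥-elim (<⇒≱ (2^n<2^[1+n] n) (≤-trans (2^-mono-≤ (ℕₚ.≰⇒> m≰n)) p))

  2^-cancel-< : ∀ m n → 2# ^ m < 2# ^ n → m ℕ.< n
  2^-cancel-< m n p = ℕₚ.≰⇒> λ n≤m → <⇒≱ p (2^-mono-≤ n≤m)

  fromℕ≤2^ : ∀ n → fromℕ n ≤ 2# ^ n
  fromℕ≤2^ zero    = 0≤1
  fromℕ≤2^ (suc n) = ≤-trans (+-mono-≤ (2^-mono-≤ (z≤n {n})) (fromℕ≤2^ n))
    (≤-reflexive (solve 1 (λ x → x :+ x := con 2 :* x) refl (2# ^ n)))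

  fromℕ-2^ : ∀ n → fromℕ (2 ℕ.^ n) ≡ 2# ^ n
  fromℕ-2^ zero    = +-identityʳ 1#
  fromℕ-2^ (suc n) = trans (fromℕ-* 2 (2 ℕ.^ n))
    (cong₂ _*_ (cong (1# +_) (+-identityʳ 1#)) (fromℕ-2^ n))

  dyadic-bracket : ∀ {x} → 2# ≤ x → ∃[ l ] 1 ℕ.≤ l × 2# ^ l ≤ x × x < 2# ^ suc l
  dyadic-bracket {x} 2≤x with archimedean x
  -- The exponent is shifted by one so that 2 ≤ x refutes the case 0, which makes the resulting l at
  -- least 1.
  ... | n , x≤n with least-change (λ n → x < 2# ^ suc n)
                       (λ x<2 → <⇒≱ x<2 (≤-trans (≤-reflexive (*-identityʳ 2#)) 2≤x)) n
                       (≤-<-trans (≤-trans x≤n (fromℕ≤2^ n)) (2^n<2^[1+n] n))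
  ...   | m , _ , x≮2^ , x<2^ = suc m , s≤s z≤n , ≮⇒≥ x≮2^ , x<2^

  -- Suprema and the logarithm

  ≤⁺-trans : ∀ {x y z} → x ≤⁺ y → y ≤⁺ z → x ≤⁺ z
  ≤⁺-trans = AddSup.≤⁺-trans _≤_ ≤-trans

  [≤]⁻ : ∀ {x y} → [ x ] ≤⁺ [ y ] → x ≤ y
  [≤]⁻ = AddSup.[≤]-injective _≤_

  sup⁺-upper : ∀ {ℓ} {P : Pred ℝ ℓ} {x} → P x → [ x ] ≤⁺ sup⁺ P
  sup⁺-upper {P = P} {x} Px with em {P = ∃⟨ P ⟩ × ∃⟨ IsUpperBound P ⟩}
  ... | yes (inhabited , bounded) = [ proj₁ (proj₂ (complete P inhabited bounded)) x Px ]
  ... | no _                      = [ x ] ≤⊤⁺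

  sup⁺-least : ∀ {ℓ} {P : Pred ℝ ℓ} {u} → ∃⟨ P ⟩ → IsUpperBound P u → sup⁺ P ≤⁺ [ u ]
  sup⁺-least {P = P} {u} P≢∅ P≤u with em {P = ∃⟨ P ⟩ × ∃⟨ IsUpperBound P ⟩}
  ... | yes (inhabited , bounded) = [ proj₂ (proj₂ (complete P inhabited bounded)) u P≤u ]
  ... | no unbounded              = ⊥-elim (unbounded (P≢∅ , u , P≤u))

  -- Some real lower bound must be supplied: `inf⁺` is a supremum of lower bounds, and `sup⁺` is
  -- `⊤⁺` on the empty set.
  inf⁺-lower : ∀ {ℓ} {P : Pred (ℝ ⁺) ℓ} {l y} → (∀ y → P y → [ l ] ≤⁺ y) → P y → inf⁺ P ≤⁺ y
  inf⁺-lower {y = ⊤⁺}    l≤P Py = _ ≤⊤⁺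
  inf⁺-lower {y = [ u ]} l≤P Py = sup⁺-least (_ , l≤P) λ l′ l′≤P → [≤]⁻ (l′≤P [ u ] Py)

  fromMaybe-≤ : ∀ {x y u} → [ x ] ≤⁺ y → y ≤⁺ [ u ] → x ≤ fromMaybe 0# y
  fromMaybe-≤ [ x≤y ] _ = x≤y

  -- The rational l / 1 lies in the set that defines `log x`. The bound by 2 ^ u makes the supremum
  -- finite; otherwise `fromMaybe` would return the default `0#`.
  ≤-log : ∀ {x} l u → 2# ^ l ≤ x → x ≤ 2# ^ u → fromℕ l ≤ log x
  ≤-log {x} l u 2^l≤x x≤2^u = fromMaybe-≤ (sup⁺-upper mem) (sup⁺-least (fromℕ l , mem) bound)
    where
    Below : ℝ → Set
    Below r = ∃[ m ] ∃[ n ] ∃[ q ] (r ≡ (fromℕ m - fromℕ n) / fromℕ (suc q)) ×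
      (2# ^ m ≤ 2# ^ n * x ^ suc q)
    1+q≢0 : ∀ q → fromℕ (suc q) ≢ 0#
    1+q≢0 q = >⇒≢ (fromℕ-pos q)
    mem : Below (fromℕ l)
    mem = l , 0 , 0 , *-cancelˡ-≡ (1+q≢0 0) eq ,
      ≤-trans 2^l≤x (≤-reflexive (sym (trans (*-identityˡ _) (*-identityʳ x))))
      where
      eq : fromℕ 1 * fromℕ l ≡ fromℕ 1 * ((fromℕ l - fromℕ 0) / fromℕ 1)
      eq = trans (cong (_* fromℕ l) (+-identityʳ 1#)) (trans (*-identityˡ _)
        (trans (sym (trans (cong (_- 0#) (sym (+-identityʳ (fromℕ l))))
          (trans (+-assoc (fromℕ l) 0# (- 0#)) (trans (cong (fromℕ l +_) (-‿inverseʳ 0#)) (+-identityʳ _)))))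
          (trans (sym (x/y*y≡x _ (1+q≢0 0))) (*-comm _ _))))
    -- From 2 ^ m ≤ 2 ^ (n + u (1 + q)), comparison of the natural exponents gives m - n ≤ u (1 +
    -- q).
    bound : IsUpperBound Below (fromℕ u)
    bound _ (m , n , q , refl , 2^m≤) = *-cancelˡ-≤ (fromℕ-pos q)
      (subst₂ _≤_ (trans (sym (x/y*y≡x _ (1+q≢0 q))) (*-comm _ _)) (fromℕ-* (suc q) u)
        (+-cancelʳ-≤ (fromℕ n) (subst₂ _≤_
          (sym (trans (+-comm _ (fromℕ n)) (x+[y-x]≡y (fromℕ n) (fromℕ m))))
          (fromℕ-+ (suc q ℕ.* u) n) (fromℕ-mono-≤ m≤))))
      where
      open ≤-Reasoning
      m≤ : m ℕ.≤ suc q ℕ.* u ℕ.+ n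
      m≤ = 2^-cancel-≤ m _ (begin
        2# ^ m                         ≤⟨ 2^m≤ ⟩
        2# ^ n * x ^ suc q             ≤⟨ *-monoˡ-≤ (proj₁ (2^n>0 n))
          (^-monoˡ-≤ (≤-trans (proj₁ (2^n>0 l)) 2^l≤x) x≤2^u (suc q)) ⟩
        2# ^ n * (2# ^ u) ^ suc q      ≡⟨ cong (2# ^ n *_) (^-assocʳ 2# u (suc q)) ⟩
        2# ^ n * 2# ^ (u ℕ.* suc q)    ≡⟨ ^-homo-* 2# n (u ℕ.* suc q) ⟨
        2# ^ (n ℕ.+ u ℕ.* suc q)       ≡⟨ cong (2# ^_) (trans (ℕₚ.+-comm n _) (cong (ℕ._+ n) (ℕₚ.*-comm u (suc q)))) ⟩
        2# ^ (suc q ℕ.* u ℕ.+ n) ∎)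

  -- Finite sums and probability

  sum-mono-≤ : ∀ {n} {f g : Fin n → ℝ} → (∀ i → f i ≤ g i) → sum f ≤ sum g
  sum-mono-≤ {zero}  f≤g = ≤-refl
  sum-mono-≤ {suc n} f≤g = +-mono-≤ (f≤g Fin.zero) (sum-mono-≤ (f≤g ∘ Fin.suc))

  bounded-Fin : ∀ {n} (f : Fin n → ℝ) → ∃[ b ] 0# ≤ b × (∀ i → f i ≤ b)
  bounded-Fin {zero}  f = 0# , ≤-refl , λ ()
  bounded-Fin {suc n} f with bounded-Fin (f ∘ Fin.suc)
  ... | b , 0≤b , f≤b with total (f Fin.zero) b
  ...   | inj₁ f₀≤b = b , 0≤b , λ { Fin.zero → f₀≤b ; (Fin.suc i) → f≤b i }
  ...   | inj₂ b≤f₀ = f Fin.zero , ≤-trans 0≤b b≤f₀ ,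
    λ { Fin.zero → ≤-refl ; (Fin.suc i) → ≤-trans (f≤b i) b≤f₀ }

  product-const : ∀ {n q} {f : Fin n → ℝ} → (∀ i → f i ≡ q) → product f ≡ q ^ n
  product-const {zero}  f≡q = refl
  product-const {suc n} f≡q = cong₂ _*_ (f≡q Fin.zero) (product-const (f≡q ∘ Fin.suc))

  module Probability (space : ProbabilitySpace) where
    open ProbabilitySpace space

    ∅-measurable : Measurable ∅
    ∅-measurable = ≐-measurable ((λ ¬⊤ → ¬⊤ tt) , λ ()) (∁-measurable U U-measurable)

    _thenConst_ : Pred Ω 0ℓ → Pred Ω 0ℓ → ℕ → Pred Ω 0ℓ
    (A thenConst B) zero    = A
    (A thenConst B) (suc _) = B

    ∪-measurable : ∀ {A B} → Measurable A → Measurable B → Measurable (A ∪ B)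
    ∪-measurable {A} {B} mA mB =
      ≐-measurable ((λ { (zero , a) → inj₁ a ; (suc _ , b) → inj₂ b }) ,
                    λ { (inj₁ a) → 0 , a ; (inj₂ b) → 1 , b })
        (⋃-measurable (A thenConst B) λ { zero → mA ; (suc _) → mB })

    ∩-measurable : ∀ {A B} → Measurable A → Measurable B → Measurable (A ∩ B)
    ∩-measurable {A} {B} mA mB =
      ≐-measurable ((λ h → em⇒dne em (h ∘ inj₁) , em⇒dne em (h ∘ inj₂)) ,
                    λ { (a , b) (inj₁ ¬a) → ¬a a ; (a , b) (inj₂ ¬b) → ¬b b })
        (∁-measurable _ (∪-measurable (∁-measurable A mA) (∁-measurable B mB)))

    -- A union of empty sets is empty, so the partial sum of two terms gives p + p ≤ p.
    ℙ-∅ : ℙ ∅ ≡ 0#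
    ℙ-∅ = antisym (+-cancelʳ-≤ p (subst (p + p ≤_) (trans p≡⋃ (sym (+-identityˡ p))) 2p≤⋃))
                  (ℙ-nonNeg ∅-measurable)
      where
      p = ℙ ∅
      p≡⋃ : ℙ (⋃ ℕ λ _ → ∅) ≡ p
      p≡⋃ = sym (ℙ-cong ((λ ()) , λ ()) ∅-measurable)
      2p≤⋃ : p + p ≤ ℙ (⋃ ℕ λ _ → ∅)
      2p≤⋃ = subst (_≤ _) (cong (p +_) (+-identityʳ p))
        (proj₁ (ℙ-σ-additive (λ _ → ∅) (λ _ → ∅-measurable) (λ _ ())) _ (2 , refl))

    ℙ-empty : ∀ {A} → (∀ ω → ¬ A ω) → ℙ A ≡ 0#
    ℙ-empty ¬A = trans (sym (ℙ-cong ((λ ()) , λ {ω} a → ¬A ω a) ∅-measurable)) ℙ-∅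

    ℙ-∪ : ∀ {A B} → Measurable A → Measurable B → A ⊥ B → ℙ (A ∪ B) ≡ ℙ A + ℙ B
    ℙ-∪ {A} {B} mA mB A⊥B = trans ℙ∪≡⋃ (antisym upper lower)
      where
      S : ℕ → Pred Ω 0ℓ
      S zero    = A
      S (suc n) = (B thenConst ∅) n
      mS : ∀ n → Measurable (S n)
      mS zero          = mA
      mS (suc zero)    = mB
      mS (suc (suc _)) = ∅-measurable
      S-disjoint : ∀ {m n} → m ≢ n → S m ⊥ S n
      S-disjoint {zero}        {zero}        m≢n _       = m≢n refl
      S-disjoint {zero}        {suc zero}    _   ab      = A⊥B ab
      S-disjoint {zero}        {suc (suc _)} _   (_ , ())
      S-disjoint {suc zero}    {zero}        _   (b , a) = A⊥B (a , b)
      S-disjoint {suc zero}    {suc zero}    m≢n _       = m≢n refl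
      S-disjoint {suc zero}    {suc (suc _)} _   (_ , ())
      S-disjoint {suc (suc _)} _ (() , _)
      ℙ∪≡⋃ : ℙ (A ∪ B) ≡ ℙ (⋃ ℕ S)
      ℙ∪≡⋃ = ℙ-cong ((λ { (inj₁ a) → 0 , a ; (inj₂ b) → 1 , b }) ,
        λ { (zero , a) → inj₁ a ; (suc zero , b) → inj₂ b ; (suc (suc _) , ()) }) (∪-measurable mA mB)
      supremum = ℙ-σ-additive S mS S-disjoint
      lower : ℙ A + ℙ B ≤ ℙ (⋃ ℕ S)
      lower = subst (_≤ ℙ (⋃ ℕ S)) (cong (ℙ A +_) (+-identityʳ (ℙ B)))
        (proj₁ supremum _ (2 , refl))
      tail≡0 : ∀ n → sum {n} (λ i → ℙ (S (suc (suc (toℕ i))))) ≡ 0#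
      tail≡0 n = trans (sum-cong-≗ {n} (λ _ → ℙ-∅)) (sum-replicate-zero n)
      partial : ∀ n → sum {n} (λ i → ℙ (S (toℕ i))) ≤ ℙ A + ℙ B
      partial zero          = +-nonNeg (ℙ-nonNeg mA) (ℙ-nonNeg mB)
      partial (suc zero)    = +-monoʳ-≤ (ℙ A) (ℙ-nonNeg mB)
      partial (suc (suc n)) = ≤-reflexive (cong (ℙ A +_)
        (trans (cong (ℙ B +_) (tail≡0 n)) (+-identityʳ (ℙ B))))
      upper : ℙ (⋃ ℕ S) ≤ ℙ A + ℙ B
      upper = proj₂ supremum _ λ { _ (n , refl) → partial n }

    ℙ-split : ∀ {A B} → Measurable A → Measurable B → ℙ A ≡ ℙ (A ∩ B) + ℙ (A ∩ ∁ B)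
    ℙ-split {A} {B} mA mB = trans
      (ℙ-cong ((λ {ω} a → decide a) , λ { (inj₁ (a , _)) → a ; (inj₂ (a , _)) → a }) mA)
      (ℙ-∪ (∩-measurable mA mB) (∩-measurable mA (∁-measurable B mB))
        λ { ((_ , b) , (_ , ¬b)) → ¬b b })
      where
      decide : A ⊆ (A ∩ B) ∪ (A ∩ ∁ B)
      decide {ω} a with em {P = B ω}
      ... | yes b = inj₁ (a , b)
      ... | no ¬b = inj₂ (a , ¬b)

    ℙ-mono : ∀ {A B} → Measurable A → Measurable B → A ⊆ B → ℙ A ≤ ℙ B
    ℙ-mono {A} {B} mA mB A⊆B = subst (_≤ ℙ B)
      (sym (ℙ-cong ((λ a → A⊆B a , a) , proj₂) mA))
      (0≤d⇒x≤y (ℙ (B ∩ ∁ A)) (ℙ-nonNeg (∩-measurable mB (∁-measurable A mA))) (sym (ℙ-split mB mA)))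

    ℙ-∁ : ∀ {A} → Measurable A → ℙ A + ℙ (∁ A) ≡ 1#
    ℙ-∁ {A} mA = trans (cong₂ _+_
        (ℙ-cong ((λ a → tt , a) , proj₂) mA)
        (ℙ-cong ((λ a → tt , a) , proj₂) (∁-measurable A mA)))
      (trans (sym (ℙ-split U-measurable mA)) ℙ-U)

    ℙ≤1 : ∀ {A} → Measurable A → ℙ A ≤ 1#
    ℙ≤1 mA = subst (ℙ _ ≤_) ℙ-U (ℙ-mono mA U-measurable _)

    -- Splitting S along the first set leaves the others inside the complement; S varies so that the
    -- induction can pass to `S ∩ ∁ (A 0)`.
    ∑ℙ-∩-≤ : ∀ {n} {A : Fin n → Pred Ω 0ℓ} {S} → (∀ i → Measurable (A i)) →
      (∀ {i j} → i ≢ j → A i ⊥ A j) → Measurable S → sum (λ i → ℙ (A i ∩ S)) ≤ ℙ S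
    ∑ℙ-∩-≤ {zero}          mA disj mS = ℙ-nonNeg mS
    ∑ℙ-∩-≤ {suc n} {A} {S} mA disj mS = subst (sum (λ i → ℙ (A i ∩ S)) ≤_) (sym (ℙ-split mS mA₀))
      (+-mono-≤ (≤-reflexive (ℙ-cong ((λ (a , s) → s , a) , λ (s , a) → a , s) (∩-measurable mA₀ mS)))
        (≤-trans (≤-reflexive (sum-cong-≗ {n} λ i →
            ℙ-cong ((λ (a , s) → a , s , λ a₀ → disj (λ ()) (a₀ , a)) , λ (a , s , _) → a , s)
              (∩-measurable (mA (Fin.suc i)) mS)))
          (∑ℙ-∩-≤ {A = A ∘ Fin.suc} (mA ∘ Fin.suc) (λ i≢j → disj (i≢j ∘ Finₚ.suc-injective))
            (∩-measurable mS (∁-measurable _ mA₀)))))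
      where
      mA₀ = mA Fin.zero

    module SimpleFunction {n : ℕ} (A : Fin n → Pred Ω 0ℓ) (c : Fin n → ℝ)
      (mA : ∀ i → Measurable (A i)) (disj : ∀ {i j} → i ≢ j → A i ⊥ A j) where

      ∫ : Pred Ω 0ℓ → ℝ
      ∫ S = sum (λ i → c i * ℙ (A i ∩ S))

      ∫-U : sum (λ i → c i * ℙ (A i)) ≡ ∫ U
      ∫-U = sum-cong-≗ λ i → cong (c i *_) (ℙ-cong ((λ a → a , tt) , proj₁) (mA i))

      ∫-cong : ∀ {S S′} → Measurable S → S ≐ S′ → ∫ S ≡ ∫ S′
      ∫-cong mS (to , from) = sum-cong-≗ λ i → cong (c i *_)
        (ℙ-cong ((λ (a , s) → a , to s) , λ (a , s) → a , from s) (∩-measurable (mA i) mS))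

      ∫-split : ∀ {S B} → Measurable S → Measurable B → ∫ S ≡ ∫ (S ∩ B) + ∫ (S ∩ ∁ B)
      ∫-split {S} {B} mS mB = trans
        (sum-cong-≗ λ i → trans
          (cong (c i *_) (trans (ℙ-split (∩-measurable (mA i) mS) mB)
            (cong₂ _+_ (ℙ-cong assoc (∩-measurable (∩-measurable (mA i) mS) mB))
              (ℙ-cong assoc (∩-measurable (∩-measurable (mA i) mS) (∁-measurable B mB))))))
          (distribˡ (c i) _ _))
        (∑-distrib-+ (λ i → c i * ℙ (A i ∩ (S ∩ B))) (λ i → c i * ℙ (A i ∩ (S ∩ ∁ B))))
        where
        assoc : ∀ {P Q R : Pred Ω 0ℓ} → (P ∩ Q) ∩ R ≐ P ∩ (Q ∩ R)
        assoc = (λ ((p , q) , r) → p , q , r) , λ (p , q , r) → (p , q) , r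

      -- The coefficients matter only where `A i` meets S, as the remaining terms vanish. The sets
      -- may fail to cover S, hence 0 ≤ g.
      ∫-≤ : ∀ {S g} → Measurable S → 0# ≤ g → (∀ i ω → A i ω → S ω → c i ≤ g) → ∫ S ≤ g * ℙ S
      ∫-≤ {S} {g} mS 0≤g c≤g = begin
        sum (λ i → c i * ℙ (A i ∩ S))   ≤⟨ sum-mono-≤ term ⟩
        sum (λ i → g * ℙ (A i ∩ S))     ≡⟨ *-distribˡ-sum g (λ i → ℙ (A i ∩ S)) ⟨
        g * sum (λ i → ℙ (A i ∩ S))     ≤⟨ *-monoˡ-≤ 0≤g (∑ℙ-∩-≤ mA disj mS) ⟩
        g * ℙ S ∎
        where
        open ≤-Reasoning
        term : ∀ i → c i * ℙ (A i ∩ S) ≤ g * ℙ (A i ∩ S)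
        term i with em {P = ∃⟨ A i ∩ S ⟩}
        ... | yes (ω , a , s) = *-monoʳ-≤ (ℙ-nonNeg (∩-measurable (mA i) mS)) (c≤g i ω a s)
        ... | no empty = ≤-reflexive (trans (cong (c i *_) ℙ≡0) (trans (zeroʳ (c i))
                (sym (trans (cong (g *_) ℙ≡0) (zeroʳ g)))))
          where ℙ≡0 = ℙ-empty λ ω as → empty (ω , as)

    𝔼-least : ∀ {Y u} → (∀ x → SimpleIntegral Y x → x ≤ u) → 𝔼 Y ≤⁺ [ u ]
    -- The simple function with no pieces, of integral 0, shows that the supremum is over a nonempty
    -- set.
    𝔼-least = sup⁺-least (0# , 0 , (λ ()) , (λ ()) , (λ ()) , (λ {i} → λ {}) , (λ ()) , (λ ()) , refl)

    -- Markov's inequality, from the simple function with the single value c on A.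
    constant-≤-𝔼 : ∀ {Y A c} → Measurable A → 0# ≤ c → (∀ ω → A ω → [ c ] ≤⁺ Y ω) → [ c * ℙ A ] ≤⁺ 𝔼 Y
    constant-≤-𝔼 {A = A} {c} mA 0≤c c≤Y = sup⁺-upper
      (1 , (λ _ → A) , (λ _ → c) , (λ _ → mA) , (λ { {Fin.zero} {Fin.zero} i≢i _ → i≢i refl }) ,
       (λ _ → 0≤c) , (λ _ → c≤Y) , sym (+-identityʳ (c * ℙ A)))

    -- The time until the first success is controlled by a potential h that dominates, in expectation,
    -- the cost of a success in trial k and its own value after a failure.
    module FirstSuccess (G : ℕ → Pred Ω 0ℓ) (mG : ∀ k → Measurable (G k)) where

      NoneBefore : ℕ → Pred Ω 0ℓ
      NoneBefore k ω = ∀ j → j ℕ.< k → ¬ G j ω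

      NoneBefore-zero : U ≐ NoneBefore 0
      NoneBefore-zero = (λ _ _ ()) , _

      NoneBefore-suc : ∀ k → NoneBefore k ∩ ∁ (G k) ≐ NoneBefore (suc k)
      NoneBefore-suc k = to , λ none → (λ j j<k → none j (ℕₚ.m≤n⇒m≤1+n j<k)) , none k ℕₚ.≤-refl
        where
        to : NoneBefore k ∩ ∁ (G k) ⊆ NoneBefore (suc k)
        to (none , ¬g) j j<1+k with ℕₚ.m≤n⇒m<n∨m≡n (s≤s⁻¹ j<1+k)
        ... | inj₁ j<k  = none j j<k
        ... | inj₂ refl = ¬g

      NoneBefore-measurable : ∀ k → Measurable (NoneBefore k)
      NoneBefore-measurable zero    = ≐-measurable NoneBefore-zero U-measurable
      NoneBefore-measurable (suc k) = ≐-measurable (NoneBefore-suc k)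
        (∩-measurable (NoneBefore-measurable k) (∁-measurable _ (mG k)))

      𝔼-≤-potential : ∀ {β q} (g h : ℕ → ℝ) {Y} →
        0# ≤ q → β + q ≡ 1# → (∀ k → ℙ (NoneBefore k) ≡ q ^ k) →
        (∀ k → 0# ≤ g k) → (∀ k ω → NoneBefore k ω → G k ω → Y ω ≤⁺ [ g k ]) →
        (∀ k → β * g k + q * h (suc k) ≤ h k) → (∀ c → ∃[ k ] c ≤ h k) →
        𝔼 Y ≤⁺ [ h 0 ]
      𝔼-≤-potential {β} {q} g h {Y} 0≤q β+q≡1 ℙNone 0≤g Y≤g drift unbounded = 𝔼-least bound
        where
        open ≤-Reasoning
        mNone = NoneBefore-measurable
        -- Removing k + 1 failures from k failures leaves q ^ k - q ^ (1 + k) = β q ^ k.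
        -- Independence enters only through this geometric law.
        ℙfirst : ∀ k → ℙ (NoneBefore k ∩ G k) ≡ β * q ^ k
        ℙfirst k = +-cancelʳ-≡ (q ^ suc k)
          (trans (cong (ℙ (NoneBefore k ∩ G k) +_) (trans (sym (ℙNone (suc k)))
              (sym (ℙ-cong (NoneBefore-suc k) (∩-measurable (mNone k) (∁-measurable _ (mG k)))))))
            (trans (sym (ℙ-split (mNone k) (mG k))) (trans (ℙNone k)
              (trans (sym (*-identityˡ (q ^ k))) (trans (cong (_* q ^ k) (sym β+q≡1))
                (distribʳ (q ^ k) β q))))))
        bound : ∀ x → SimpleIntegral Y x → x ≤ h 0
        -- For K with h K ≥ max c, what remains of the integral after K failures is at most h K * q ^ K.
        bound _ (n , A , c , mA , disj , 0≤c , c≤Y , refl) with bounded-Fin c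
        ... | b , 0≤b , c≤b with unbounded b
        ...   | K , b≤hK = +-cancelʳ-≤ (h K * q ^ K) (begin
          sum (λ i → c i * ℙ (A i)) + h K * q ^ K ≡⟨ cong (_+ h K * q ^ K) ∫-U ⟩
          ∫ U + h K * q ^ K                       ≤⟨ potential K ⟩
          h 0 + ∫ (NoneBefore K)                  ≤⟨ +-monoʳ-≤ (h 0) (∫-≤ (mNone K) 0≤b λ i _ _ _ → c≤b i) ⟩
          h 0 + b * ℙ (NoneBefore K)              ≡⟨ cong (λ p → h 0 + b * p) (ℙNone K) ⟩
          h 0 + b * q ^ K                         ≤⟨ +-monoʳ-≤ (h 0) (*-monoʳ-≤ (^-nonNeg 0≤q K) b≤hK) ⟩
          h 0 + h K * q ^ K ∎)
          where
          open SimpleFunction A c mA disj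
          -- The successes before trial k contribute `∫ U` - `∫ (NoneBefore k)`, which is at most
          -- the drop of the expected potential from `h 0` to `h k * q ^ k`; the subtractions are
          -- moved across.
          potential : ∀ k → ∫ U + h k * q ^ k ≤ h 0 + ∫ (NoneBefore k)
          potential zero = ≤-reflexive (trans (+-comm _ _)
            (cong₂ _+_ (*-identityʳ (h 0)) (∫-cong U-measurable NoneBefore-zero)))
          potential (suc k) = +-cancelʳ-≤ (β * q ^ k * g k) (begin
            ∫ U + h (suc k) * (q * q ^ k) + β * q ^ k * g k
              ≡⟨ solve 6 (λ i h q r β g → i :+ h :* (q :* r) :+ β :* r :* g
                    := i :+ (β :* g :+ q :* h) :* r) refl (∫ U) (h (suc k)) q (q ^ k) β (g k) ⟩
            ∫ U + (β * g k + q * h (suc k)) * q ^ k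
              ≤⟨ +-monoʳ-≤ (∫ U) (*-monoʳ-≤ (^-nonNeg 0≤q k) (drift k)) ⟩
            ∫ U + h k * q ^ k                ≤⟨ potential k ⟩
            h 0 + ∫ (NoneBefore k)           ≡⟨ cong (h 0 +_) (∫-split (mNone k) (mG k)) ⟩
            h 0 + (∫ (NoneBefore k ∩ G k) + ∫ (NoneBefore k ∩ ∁ (G k)))
              ≤⟨ +-monoʳ-≤ (h 0) (+-monoˡ-≤ _ first) ⟩
            h 0 + (g k * ℙ (NoneBefore k ∩ G k) + ∫ (NoneBefore k ∩ ∁ (G k)))
              ≡⟨ cong₂ (λ p i → h 0 + (g k * p + i)) (ℙfirst k)
                   (∫-cong (∩-measurable (mNone k) (∁-measurable _ (mG k))) (NoneBefore-suc k)) ⟩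
            h 0 + (g k * (β * q ^ k) + ∫ (NoneBefore (suc k)))
              ≡⟨ solve 5 (λ h g β r i → h :+ (g :* (β :* r) :+ i) := h :+ i :+ β :* r :* g) refl
                   (h 0) (g k) β (q ^ k) (∫ (NoneBefore (suc k))) ⟩
            h 0 + ∫ (NoneBefore (suc k)) + β * q ^ k * g k ∎)
            where
            first : ∫ (NoneBefore k ∩ G k) ≤ g k * ℙ (NoneBefore k ∩ G k)
            first = ∫-≤ (∩-measurable (mNone k) (mG k)) (0≤g k)
              λ i ω a (none , gk) → [≤]⁻ (≤⁺-trans (c≤Y i ω a) (Y≤g k ω none gk))

  -- Minimality of R

  module Profile (alg : Algorithm) where
    open Algorithm alg
    open Probability space

    ≤-measurable : ∀ t → Measurable (λ ω → X ω ≤⁺ [ t ])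
    ≤-measurable t = X-measurable (_≤⁺ [ t ]) (ray-borel t)

    ℙ-nonNeg-≤ : ∀ t → 0# ≤ ℙ[X≤ t ]
    ℙ-nonNeg-≤ t = ℙ-nonNeg (≤-measurable t)

    R-⊤ : ∀ {α} → ℙ[X≤ α ] ≡ 0# → R α ≡ ⊤⁺
    R-⊤ {α} p≡0 with em {P = ℙ[X≤ α ] ≡ 0#}
    ... | yes _  = refl
    ... | no p≢0 = ⊥-elim (p≢0 p≡0)

    R-finite : ∀ {α} → ℙ[X≤ α ] ≢ 0# → R α ≡ [ α / ℙ[X≤ α ] ]
    R-finite {α} p≢0 with em {P = ℙ[X≤ α ] ≡ 0#}
    ... | yes p≡0 = ⊥-elim (p≢0 p≡0)
    ... | no _    = refl

    restrict-∈ : ∀ {B Y ω} → B ω → restrict B Y ω ≡ Y ω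
    restrict-∈ {B} {ω = ω} b with em {P = B ω}
    ... | yes _ = refl
    ... | no ¬b = ⊥-elim (¬b b)

    restrict-∉ : ∀ {B Y ω} → ¬ B ω → restrict B Y ω ≡ [ 0# ]
    restrict-∉ {B} {ω = ω} ¬b with em {P = B ω}
    ... | yes b = ⊥-elim (¬b b)
    ... | no _  = refl

    𝔼-restrict-≤ : ∀ {Y : Ω → ℝ ⁺} {t} → 0# ≤ t → Measurable (λ ω → Y ω ≤⁺ [ t ]) →
      𝔼 (restrict (λ ω → Y ω ≤⁺ [ t ]) Y) ≤⁺ [ t * ℙ (λ ω → Y ω ≤⁺ [ t ]) ]
    𝔼-restrict-≤ {Y} {t} 0≤t mB = 𝔼-least bound
      where
      open ≤-Reasoning
      B = λ ω → Y ω ≤⁺ [ t ]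
      bound : ∀ x → SimpleIntegral (restrict B Y) x → x ≤ t * ℙ B
      bound _ (n , A , c , mA , disj , 0≤c , c≤Y , refl) = begin
        sum (λ i → c i * ℙ (A i))         ≡⟨ ∫-U ⟩
        ∫ U                               ≡⟨ ∫-split U-measurable mB ⟩
        ∫ (U ∩ B) + ∫ (U ∩ ∁ B)           ≤⟨ +-mono-≤
          (∫-≤ (∩-measurable U-measurable mB) 0≤t
            λ i ω a (_ , b) → [≤]⁻ (≤⁺-trans (subst ([ c i ] ≤⁺_) (restrict-∈ {B} {Y} b) (c≤Y i ω a)) b))
          (∫-≤ (∩-measurable U-measurable (∁-measurable B mB)) ≤-refl
            λ i ω a (_ , ¬b) → [≤]⁻ (subst ([ c i ] ≤⁺_) (restrict-∉ {B} {Y} ¬b) (c≤Y i ω a))) ⟩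
        t * ℙ (U ∩ B) + 0# * ℙ (U ∩ ∁ B)  ≡⟨ cong₂ _+_
          (cong (t *_) (sym (ℙ-cong ((λ b → tt , b) , proj₂) mB))) (zeroˡ _) ⟩
        t * ℙ B + 0#                      ≡⟨ +-identityʳ _ ⟩
        t * ℙ B ∎
        where open SimpleFunction A c mA disj

    -- With e the integral of X over X ≤ t and r the probability of X > t, the right side is
    -- 𝔼[min X t]; thus `f t` is that expectation divided by p.
    f-value-* : ∀ {p} → p ≢ 0# → ∀ e r t → (e / p + (r / p) * t) * p ≡ e + r * t
    f-value-* {p} p≢0 e r t = trans
      (solve 4 (λ a b t p → (a :+ b :* t) :* p := a :* p :+ (b :* p) :* t) refl (e / p) (r / p) t p)
      (cong₂ (λ a b → a + b * t) (x/y*y≡x e p≢0) (x/y*y≡x r p≢0))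

    module _ {∇ o : ℝ} (argmin : IsArgminR ∇) (𝒪≡o : 𝒪 ≡ [ o ]) where
      open ≤-Reasoning

      private
        β = ℙ[X≤ ∇ ]
        M = ∇ / β

      0≤∇ : 0# ≤ ∇
      0≤∇ = proj₁ (proj₁ argmin)

      -- If β vanished, R would be infinite everywhere, hence no threshold would be admissible in 𝒪.
      β≢0 : β ≢ 0#
      β≢0 β≡0 = <⇒≱ (x<1+x o) ([≤]⁻ (subst ([ 1# + o ] ≤⁺_) 𝒪≡o (sup⁺-upper λ y (t , 0<t , 0<p , _) →
        ⊥-elim (>⇒≢ 0<p (p≡0 t 0<t)))))
        where
        ⊤≰R : ∀ t → ℙ[X≤ t ] ≢ 0# → ¬ (⊤⁺ ≤⁺ R t)
        ⊤≰R t p≢0 ⊤≤R with subst (⊤⁺ ≤⁺_) (R-finite p≢0) ⊤≤R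
        ... | ()
        p≡0 : ∀ t → 0# < t → ℙ[X≤ t ] ≡ 0#
        p≡0 t 0<t with em {P = ℙ[X≤ t ] ≡ 0#}
        ... | yes p≡0 = p≡0
        ... | no p≢0 = ⊥-elim (⊤≰R t p≢0 (subst (_≤⁺ R t) (R-⊤ β≡0) (proj₂ argmin t 0<t)))

      0<β : 0# < β
      0<β = ℙ-nonNeg-≤ ∇ , β≢0 ∘ sym

      M*β≡∇ : M * β ≡ ∇
      M*β≡∇ = x/y*y≡x ∇ β≢0

      0≤M : 0# ≤ M
      0≤M = *-nonNeg 0≤∇ (⁻¹-nonNeg 0<β)

      -- Since X ≥ 1, a smaller ∇ would have β = 0. This absorbs rounding: ⌈∇⌉ ≤ 1 + ∇ ≤ 2∇.
      1≤∇ : 1# ≤ ∇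
      1≤∇ with em {P = 1# ≤ ∇}
      ... | yes p = p
      ... | no 1≰∇ = ⊥-elim (β≢0 (ℙ-empty λ ω X≤∇ → 1≰∇ ([≤]⁻ (≤⁺-trans (1≤X ω) X≤∇))))

      M*ℙ≤ : ∀ t → 0# < t → M * ℙ[X≤ t ] ≤ t
      M*ℙ≤ t 0<t with em {P = ℙ[X≤ t ] ≡ 0#}
      ... | yes p≡0 = subst (_≤ t) (sym (trans (cong (M *_) p≡0) (zeroʳ M))) (proj₁ 0<t)
      ... | no p≢0 = ≤-trans (*-monoʳ-≤ (ℙ-nonNeg-≤ t)
        ([≤]⁻ (subst₂ _≤⁺_ (R-finite β≢0) (R-finite p≢0) (proj₂ argmin t 0<t)))) (≤-reflexive (x/y*y≡x t p≢0))

      -- Multiplied by β, `f ∇` is 𝔼[min X ∇], at most ∇.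
      f∇≤M : f ∇ ≤⁺ [ M ]
      f∇≤M = go (𝔼-restrict-≤ 0≤∇ (≤-measurable ∇))
        where
        r = ℙ[X> ∇ ]
        go : ∀ {y} → y ≤⁺ [ ∇ * β ] → map⁺ (_+ (r / β) * ∇) (map⁺ (_/ β) y) ≤⁺ [ M ]
        go {[ e ]} [ e≤ ] = [ *-cancelˡ-≤ 0<β (begin
          β * (e / β + (r / β) * ∇)  ≡⟨ *-comm β _ ⟩
          (e / β + (r / β) * ∇) * β  ≡⟨ f-value-* β≢0 e r ∇ ⟩
          e + r * ∇                  ≤⟨ +-monoˡ-≤ (r * ∇) e≤ ⟩
          ∇ * β + r * ∇              ≡⟨ solve 3 (λ t b r → t :* b :+ r :* t := t :* (b :+ r)) refl ∇ β r ⟩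
          ∇ * (β + r)                ≡⟨ cong (∇ *_) (ℙ-∁ (≤-measurable ∇)) ⟩
          ∇ * 1#                     ≡⟨ *-identityʳ ∇ ⟩
          ∇                          ≡⟨ M*β≡∇ ⟨
          M * β                      ≡⟨ *-comm M β ⟩
          β * M ∎) ]

      -- With m = min t M and s = m / 2, at least half of the mass lies above s, so that already the
      -- runs longer than s contribute m / 4 to 𝔼[min X t].
      M*ℙ≤4𝔼 : ∀ t → 0# < t → ∃[ s ] 0# ≤ s ×
        (∀ e → s * ℙ (λ ω → X ω ≤⁺ [ t ] × ¬ (X ω ≤⁺ [ s ])) ≤ e →
          M * ℙ[X≤ t ] ≤ 4# * (e + ℙ[X> t ] * t))
      M*ℙ≤4𝔼 t 0<t = s , proj₁ 0<s , λ e se≤e → begin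
          M * ℙ[X≤ t ]                          ≤⟨ Mp≤m ⟩
          m                                     ≡⟨ s+s≡m ⟨
          s + s                                 ≡⟨ solve 1 (λ s → s :+ s := con 2 :* (s :* con 1)) refl s ⟩
          2# * (s * 1#)                         ≤⟨ *-monoˡ-≤ 0≤2 (*-monoˡ-≤ (proj₁ 0<s) 1≤2u) ⟩
          2# * (s * (2# * u))                   ≡⟨ solve 2 (λ s u → con 2 :* (s :* (con 2 :* u)) := con 4 :* (s :* u)) refl s u ⟩
          4# * (s * u)                          ≤⟨ *-monoˡ-≤ 0≤4 (*-monoˡ-≤ (proj₁ 0<s) u≤) ⟩
          4# * (s * (ℙ In + r))                 ≡⟨ cong (4# *_) (trans (distribˡ s _ _) (cong (s * ℙ In +_) (*-comm s r))) ⟩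
          4# * (s * ℙ In + r * s)               ≤⟨ *-monoˡ-≤ 0≤4 (+-mono-≤ se≤e (*-monoˡ-≤ (ℙ-nonNeg X>t) s≤t)) ⟩
          4# * (e + r * t) ∎
        where
        0<M : 0# < M
        0<M = 0≤M , λ 0≡M → proj₂ (proj₁ argmin) (trans (sym (zeroˡ β)) (trans (cong (_* β) 0≡M) M*β≡∇))
        minimum : ∃[ m ] 0# < m × m ≤ t × m ≤ M × M * ℙ[X≤ t ] ≤ m
        minimum with total t M
        ... | inj₁ t≤M = t , 0<t , ≤-refl , t≤M , M*ℙ≤ t 0<t
        ... | inj₂ M≤t = M , 0<M , M≤t , ≤-refl ,
          ≤-trans (*-monoˡ-≤ 0≤M (ℙ≤1 (≤-measurable t))) (≤-reflexive (*-identityʳ M))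
        m = proj₁ minimum
        m≤t = proj₁ (proj₂ (proj₂ minimum))
        m≤M = proj₁ (proj₂ (proj₂ (proj₂ minimum)))
        Mp≤m = proj₂ (proj₂ (proj₂ (proj₂ minimum)))
        s = m / 2#
        s+s≡m : s + s ≡ m
        s+s≡m = trans (solve 1 (λ s → s :+ s := s :* con 2) refl s) (x/y*y≡x m (>⇒≢ 0<2))
        0<s : 0# < s
        0<s = *-nonNeg (proj₁ (proj₁ (proj₂ minimum))) (⁻¹-nonNeg 0<2) ,
          λ 0≡s → proj₂ (proj₁ (proj₂ minimum)) (trans (sym (+-identityˡ 0#)) (trans (cong₂ _+_ 0≡s 0≡s) s+s≡m))
        s≤t : s ≤ t
        s≤t = ≤-trans (0≤d⇒x≤y s (proj₁ 0<s) s+s≡m) m≤t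
        p = ℙ[X≤ s ]
        u = ℙ[X> s ]
        r = ℙ[X> t ]
        p+u≡1 : p + u ≡ 1#
        p+u≡1 = ℙ-∁ (≤-measurable s)
        2p≤1 : 2# * p ≤ 1#
        2p≤1 = *-cancelˡ-≤ 0<M (begin
          M * (2# * p)      ≡⟨ solve 2 (λ M p → M :* (con 2 :* p) := M :* p :+ M :* p) refl M p ⟩
          M * p + M * p     ≤⟨ +-mono-≤ (M*ℙ≤ s 0<s) (M*ℙ≤ s 0<s) ⟩
          s + s             ≡⟨ s+s≡m ⟩
          m                 ≤⟨ m≤M ⟩
          M                 ≡⟨ *-identityʳ M ⟨
          M * 1# ∎)
        1≤2u : 1# ≤ 2# * u
        1≤2u = +-cancelʳ-≤ (2# * p) (begin
          1# + 2# * p       ≤⟨ +-monoʳ-≤ 1# 2p≤1 ⟩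
          1# + 1#           ≡⟨ cong₂ _+_ p+u≡1 p+u≡1 ⟨
          (p + u) + (p + u) ≡⟨ solve 2 (λ p u → (p :+ u) :+ (p :+ u) := con 2 :* u :+ con 2 :* p) refl p u ⟩
          2# * u + 2# * p ∎)
        In : Pred Ω 0ℓ
        In ω = X ω ≤⁺ [ t ] × ¬ (X ω ≤⁺ [ s ])
        X>s = ∁-measurable _ (≤-measurable s)
        X>t = ∁-measurable _ (≤-measurable t)
        -- The mass above s is split at t: the runs in `In` enter e with weight at least s, and
        -- those beyond t enter `r * t` with weight t ≥ s.
        u≤ : u ≤ ℙ In + r
        u≤ = begin
          u  ≡⟨ ℙ-split X>s (≤-measurable t) ⟩
          ℙ (∁ (λ ω → X ω ≤⁺ [ s ]) ∩ (λ ω → X ω ≤⁺ [ t ])) + ℙ (∁ (λ ω → X ω ≤⁺ [ s ]) ∩ ∁ (λ ω → X ω ≤⁺ [ t ]))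
             ≤⟨ +-mono-≤ (≤-reflexive (ℙ-cong ((λ (a , b) → b , a) , λ (a , b) → b , a) (∩-measurable X>s (≤-measurable t))))
                  (ℙ-mono (∩-measurable X>s X>t) X>t proj₂) ⟩
          ℙ In + r ∎

      -- An infinite integral makes the claim trivial. A finite one is the e of `M*ℙ≤4𝔼`, which is
      -- stated for every e so that it can be applied after this case distinction.
      M/4≤f : ∀ t → 0# < t → 0# < ℙ[X≤ t ] → [ M / 4# ] ≤⁺ f t
      M/4≤f t 0<t 0<p = let s , 0≤s , M*p≤ = M*ℙ≤4𝔼 t 0<t in bound s 0≤s M*p≤
        where
        p = ℙ[X≤ t ]
        r = ℙ[X> t ]
        p≢0 = >⇒≢ 0<p
        bound : ∀ s → 0# ≤ s →
          (∀ e → s * ℙ (λ ω → X ω ≤⁺ [ t ] × ¬ (X ω ≤⁺ [ s ])) ≤ e → M * p ≤ 4# * (e + r * t)) →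
          [ M / 4# ] ≤⁺ f t
        bound s 0≤s M*p≤ = go (constant-≤-𝔼 {restrict (λ ω → X ω ≤⁺ [ t ]) X} {In} {s} mIn 0≤s
          λ ω (X≤t , X≰s) → subst ([ s ] ≤⁺_) (sym (restrict-∈ {λ ω → X ω ≤⁺ [ t ]} {X} X≤t)) (>s X≰s))
          where
          In : Pred Ω 0ℓ
          In ω = X ω ≤⁺ [ t ] × ¬ (X ω ≤⁺ [ s ])
          mIn : Measurable In
          mIn = ∩-measurable (≤-measurable t) (∁-measurable _ (≤-measurable s))
          >s : ∀ {y} → ¬ (y ≤⁺ [ s ]) → [ s ] ≤⁺ y
          >s {[ x ]} x≰s = [ ≰⇒≥ (x≰s ∘ [_]) ]
          >s {⊤⁺}    _   = _ ≤⊤⁺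
          go : ∀ {y} → [ s * ℙ In ] ≤⁺ y →
            [ M / 4# ] ≤⁺ map⁺ (_+ (r / p) * t) (map⁺ (_/ p) y)
          go {⊤⁺}    _       = _ ≤⊤⁺
          go {[ e ]} [ ≤e ] = [ *-cancelˡ-≤ 0<p (*-cancelˡ-≤ 0<4 (begin
            4# * (p * (M / 4#))               ≡⟨ solve 3 (λ a p m → a :* (p :* m) := (m :* a) :* p) refl 4# p (M / 4#) ⟩
            ((M / 4#) * 4#) * p               ≡⟨ cong (_* p) (x/y*y≡x M (>⇒≢ 0<4)) ⟩
            M * p                             ≤⟨ M*p≤ e ≤e ⟩
            4# * (e + r * t)                  ≡⟨ cong (4# *_) (f-value-* p≢0 e r t) ⟨
            4# * ((e / p + (r / p) * t) * p)  ≡⟨ cong (4# *_) (*-comm _ p) ⟩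
            4# * (p * (e / p + (r / p) * t)) ∎)) ]

      private
        -- Serves both comparisons with 𝒪: as the bound itself in `M≤4𝒪`, and as the lower bound
        -- demanded by `inf⁺-lower` in `𝒪≤M`.
        M/4-lower : ∀ y → (∃[ t ] (0# < t) × (0# < ℙ[X≤ t ]) × (y ≡ f t)) → [ M / 4# ] ≤⁺ y
        M/4-lower y (t , 0<t , 0<p , refl) = M/4≤f t 0<t 0<p

      M≤4𝒪 : M ≤ 4# * o
      M≤4𝒪 = begin
        M               ≡⟨ x/y*y≡x M (>⇒≢ 0<4) ⟨
        (M / 4#) * 4#   ≡⟨ *-comm _ 4# ⟩
        4# * (M / 4#)   ≤⟨ *-monoˡ-≤ (proj₁ 0<4) ([≤]⁻ (subst ([ M / 4# ] ≤⁺_) 𝒪≡o (sup⁺-upper M/4-lower))) ⟩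
        4# * o ∎

      -- Carries 2 ≤ 𝒪 over to M, so that M has a dyadic bracket with positive exponent.
      𝒪≤M : o ≤ M
      𝒪≤M = [≤]⁻ (subst (_≤⁺ [ M ]) 𝒪≡o
        (≤⁺-trans (inf⁺-lower M/4-lower (∇ , proj₁ argmin , 0<β , refl)) f∇≤M))

  -- The wide search

  module Trials {alg : Algorithm} (copies : Copies alg) where
    private module alg = Algorithm alg
    open Copies copies
    open Probability space

    module _ (t : ℝ) where

      G : ℕ → Pred Ω 0ℓ
      G k ω = A k ω ≤⁺ [ t ]

      G-measurable : ∀ k → Measurable (G k)
      G-measurable k = A-measurable k (_≤⁺ [ t ]) (ray-borel t)

      open FirstSuccess G G-measurable

      ℙ-NoneBefore : ∀ k → ℙ (NoneBefore k) ≡ alg.ℙ[X> t ] ^ k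
      ℙ-NoneBefore k = trans (ℙ-cong (to , from) (NoneBefore-measurable k))
        (trans (A-independent k (λ _ → ∁ (_≤⁺ [ t ])) (λ _ → ∁-borel (ray-borel t)))
          (product-const {k} λ i → A-law (toℕ i) _ (∁-borel (ray-borel t))))
        where
        to : NoneBefore k ⊆ ⋂ (Fin k) (λ i → A (toℕ i) ⊢ ∁ (_≤⁺ [ t ]))
        to none i = none (toℕ i) (Finₚ.toℕ<n i)
        from : ⋂ (Fin k) (λ i → A (toℕ i) ⊢ ∁ (_≤⁺ [ t ])) ⊆ NoneBefore k
        from {ω} none j j<k = subst (λ j → ¬ G j ω) (Finₚ.toℕ-fromℕ< j<k) (none (fromℕ< j<k))

    -- As T is an infimum over all terminations, any terminating copy bounds it, whether or not it
    -- is the earliest.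
    T-≤ : ∀ {j ω s} → TerminatesIn j s ω → T ω ≤⁺ [ fromℕ (allotted j (suc s) ℕ.+ othersTime j s) ]
    T-≤ {j} {ω} {s} terminates = ≤⁺-trans (inf⁺-lower nonNeg (j , s , terminates , refl))
      (subst (λ x → map⁺ (_+ fromℕ (othersTime j s)) (A j ω) ≤⁺ [ x ]) (sym (fromℕ-+ (allotted j (suc s)) (othersTime j s)))
        (shift (proj₂ terminates)))
      where
      shift : ∀ {y u v} → y ≤⁺ [ u ] → map⁺ (_+ v) y ≤⁺ [ u + v ]
      shift [ y≤u ] = [ +-monoˡ-≤ _ y≤u ]
      shift-nonNeg : ∀ {y} n → [ 1# ] ≤⁺ y → [ 0# ] ≤⁺ map⁺ (_+ fromℕ n) y
      shift-nonNeg n [ 1≤y ]  = [ +-nonNeg (≤-trans 0≤1 1≤y) (fromℕ-nonNeg n) ]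
      shift-nonNeg n (_ ≤⊤⁺) = _ ≤⊤⁺
      nonNeg : ∀ y → (∃[ j ] ∃[ s ] TerminatesIn j s ω × (y ≡ map⁺ (_+ fromℕ (othersTime j s)) (A j ω))) → [ 0# ] ≤⁺ y
      nonNeg _ (j , s , _ , refl) = shift-nonNeg (othersTime j s) (1≤A j ω)

    terminates-by : ∀ {j ω} n → A j ω ≤⁺ [ fromℕ n ] → ∃[ s ] suc s ℕ.≤ n ℕ.* suc j × TerminatesIn j s ω
    terminates-by {j} {ω} n A≤n = least-change (λ t → A j ω ≤⁺ [ fromℕ (allotted j t) ])
      -- At simulation time 0 the copy has 0 seconds, fewer than the minimal running time 1; at time
      -- n (1 + j) it has exactly n.
      (λ A≤0 → <⇒≱ 0<1 ([≤]⁻ (≤⁺-trans (1≤A j ω) (subst (λ m → A j ω ≤⁺ [ fromℕ m ]) (0/n≡0 (suc j)) A≤0))))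
      (n ℕ.* suc j) (subst (λ m → A j ω ≤⁺ [ fromℕ m ]) (sym (m*n/n≡m n (suc j))) A≤n)

  -- For x = β (1 + k) and y = β k, cost bounds the time of the search if copy k is the first one that
  -- needs at most ∇, and potential M ℓ 1# y its expectation given that the first k copies need more than ∇.
  -- The variable u stands for 1 = β + q, which turns the drift condition into a semiring identity.
  cost : ℝ → ℝ → ℝ → ℝ
  cost M ℓ x = (2# * M) * ((1# + ℓ) * x + 4# * (x * x))

  potential : ℝ → ℝ → ℝ → ℝ → ℝ
  potential M ℓ u y = (2# * M) * ((1# + ℓ) * (y + u) + 4# * (y * y + 2# * (y * u) + 2# * (u * u)))

  -- For K geometric with parameter β, the variable β K has mean 1 and second moment 2 - β.
  -- `potential` uses 1 and 2 instead (the moments of an exponential variable), so its linear part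
  -- is exact and its quadratic part too large by a constant 8 M β; after one trial this leaves
  -- exactly `slack 1#` = 8 M β².
  potential-drift : ∀ {M β q} ℓ y → 0# ≤ M → 0# ≤ β → β + q ≡ 1# →
    β * cost M ℓ (β + y) + q * potential M ℓ 1# (β + y) ≤ potential M ℓ 1# y
  potential-drift {M} {β} {q} ℓ y 0≤M 0≤β β+q≡1 = 0≤d⇒x≤y (slack 1#)
    (*-nonNeg (*-nonNeg 0≤2 0≤M) (*-nonNeg (*-nonNeg 0≤4 (*-nonNeg 0≤β 0≤β)) 0≤1))
    (trans (subst (λ u → β * cost M ℓ (β + y) + q * potential M ℓ u (β + y) + slack u ≡ u * potential M ℓ u y)
      β+q≡1 identity) (*-identityˡ _))
    where
    slack : ℝ → ℝ
    slack u = (2# * M) * ((4# * (β * β)) * u)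
    identity : β * cost M ℓ (β + y) + q * potential M ℓ (β + q) (β + y) + slack (β + q) ≡ (β + q) * potential M ℓ (β + q) y
    identity = solve 5 (λ M β q ℓ y →
      let u = β :+ q
          x = β :+ y
          C = λ z → (con 2 :* M) :* ((con 1 :+ ℓ) :* z :+ con 4 :* (z :* z))
          P = λ z → (con 2 :* M) :* ((con 1 :+ ℓ) :* (z :+ u) :+ con 4 :* (z :* z :+ con 2 :* (z :* u) :+ con 2 :* (u :* u)))
      in β :* C x :+ q :* P x :+ (con 2 :* M) :* ((con 4 :* (β :* β)) :* u) := u :* P y) refl M β q ℓ y

  cost-nonNeg : ∀ {M ℓ x} → 0# ≤ M → 0# ≤ ℓ → 0# ≤ x → 0# ≤ cost M ℓ x
  cost-nonNeg 0≤M 0≤ℓ 0≤x = *-nonNeg (*-nonNeg 0≤2 0≤M)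
    (+-nonNeg (*-nonNeg (+-nonNeg 0≤1 0≤ℓ) 0≤x) (*-nonNeg 0≤4 (*-nonNeg 0≤x 0≤x)))

  M*y≤potential : ∀ {M ℓ y} → 0# ≤ M → 0# ≤ ℓ → 0# ≤ y → M * y ≤ potential M ℓ 1# y
  M*y≤potential {M} {ℓ} {y} 0≤M 0≤ℓ 0≤y = 0≤d⇒x≤y
    (M * y + 2# * M * (1# + ℓ * (y + 1#) + 4# * (y * y + 2# * (y * 1#) + 2# * (1# * 1#))))
    (+-nonNeg (*-nonNeg 0≤M 0≤y) (*-nonNeg (*-nonNeg 0≤2 0≤M)
      (+-nonNeg (+-nonNeg 0≤1 (*-nonNeg 0≤ℓ (+-nonNeg 0≤y 0≤1)))
        (*-nonNeg 0≤4
          (+-nonNeg (+-nonNeg (*-nonNeg 0≤y 0≤y) (*-nonNeg 0≤2 (*-nonNeg 0≤y 0≤1)))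
                    (*-nonNeg 0≤2 (*-nonNeg 0≤1 0≤1)))))))
    (solve 3 (λ M ℓ y → M :* y :+ (M :* y :+ con 2 :* M :* (con 1 :+ ℓ :* (y :+ con 1)
          :+ con 4 :* (y :* y :+ con 2 :* (y :* con 1) :+ con 2 :* (con 1 :* con 1))))
      := (con 2 :* M) :* ((con 1 :+ ℓ) :* (y :+ con 1)
          :+ con 4 :* (y :* y :+ con 2 :* (y :* con 1) :+ con 2 :* (con 1 :* con 1)))) refl M ℓ y)

  -- The left side is 2 M (9 + ℓ), with equality at ℓ = 1. Writing ℓ = 1 + d leaves the slack 18 M
  -- d.
  potential-zero-≤ : ∀ {M ℓ} → 0# ≤ M → 1# ≤ ℓ → potential M ℓ 1# 0# ≤ fromℕ 20 * (M * ℓ)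
  potential-zero-≤ {M} {ℓ} 0≤M 1≤ℓ = subst (λ c → potential M ℓ 1# 0# ≤ c * (M * ℓ)) (sym (×ᵤ≈× semiring 20 1#))
    (subst (λ ℓ → potential M ℓ 1# 0# ≤ _ * (M * ℓ)) (x+[y-x]≡y 1# ℓ)
      (0≤d⇒x≤y (4# * (4# * (M * d)) + 2# * (M * d))
        (+-nonNeg (*-nonNeg 0≤4 (*-nonNeg 0≤4 0≤Md)) (*-nonNeg 0≤2 0≤Md))
        (solve 2 (λ M d → (con 2 :* M) :* ((con 1 :+ (con 1 :+ d)) :* (con 0 :+ con 1) :+ con 4 :*
            (con 0 :* con 0 :+ con 2 :* (con 0 :* con 1) :+ con 2 :* (con 1 :* con 1)))
            :+ (con 4 :* (con 4 :* (M :* d)) :+ con 2 :* (M :* d))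
          := con 20 :* (M :* (con 1 :+ d))) refl M d)))
    where
    d = ℓ - 1#
    0≤Md : 0# ≤ M * d
    0≤Md = *-nonNeg 0≤M (x≤y⇒0≤y-x 1≤ℓ)

  -- In the application D = 2 ^ l, N bounds the simulation time and W is the total time.
  cost-bounds-time : ∀ {M ℓ D N W x} → 0# < D → D ≤ M → M ≤ 2# * D → 0# ≤ x → 0# ≤ ℓ → 0# ≤ N → N ≤ (2# * M) * x →
    D * W ≤ D * (N * (1# + ℓ)) + N * N → W ≤ cost M ℓ x
  cost-bounds-time {M} {ℓ} {D} {N} {W} {x} 0<D D≤M M≤2D 0≤x 0≤ℓ 0≤N N≤ DW≤ = *-cancelˡ-≤ 0<D (begin
    D * W                              ≤⟨ DW≤ ⟩
    D * (N * (1# + ℓ)) + N * N         ≤⟨ +-mono-≤ (*-monoˡ-≤ (proj₁ 0<D) (*-monoʳ-≤ (+-nonNeg 0≤1 0≤ℓ) N≤))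
                                            (*-mono-≤ 0≤N (≤-trans 0≤N N≤) N≤ N≤) ⟩
    -- One factor M of `z * z` is isolated and then traded for `2# * D`, so that D can be cancelled
    -- from both summands.
    D * (z * (1# + ℓ)) + z * z         ≡⟨ cong (D * (z * (1# + ℓ)) +_)
      (solve 2 (λ M x → (con 2 :* M :* x) :* (con 2 :* M :* x) := (con 2 :* M) :* (con 2 :* (x :* x)) :* M) refl M x) ⟩
    D * (z * (1# + ℓ)) + (2# * M) * (2# * (x * x)) * M
      ≤⟨ +-monoʳ-≤ _ (*-monoˡ-≤ (*-nonNeg (*-nonNeg 0≤2 0≤M) (*-nonNeg 0≤2 (*-nonNeg 0≤x 0≤x))) M≤2D) ⟩
    D * (z * (1# + ℓ)) + (2# * M) * (2# * (x * x)) * (2# * D)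
      ≡⟨ solve 4 (λ D M x ℓ → D :* (con 2 :* M :* x :* (con 1 :+ ℓ)) :+ (con 2 :* M) :* (con 2 :* (x :* x)) :* (con 2 :* D)
           := D :* ((con 2 :* M) :* ((con 1 :+ ℓ) :* x :+ con 4 :* (x :* x)))) refl D M x ℓ ⟩
    D * cost M ℓ x ∎)
    where
    open ≤-Reasoning
    z = 2# * M * x
    0≤M = ≤-trans (proj₁ 0<D) D≤M

  20*4*3≡240 : ∀ x y → fromℕ 20 * (4# * x * (fromℕ 3 * y)) ≡ fromℕ 240 * (x * y)
  20*4*3≡240 x y = trans
    (solve 5 (λ a b c x y → a :* (b :* x :* (c :* y)) := (a :* (b :* c)) :* (x :* y)) refl (fromℕ 20) 4# (fromℕ 3) x y)
    (cong (_* (x * y)) (trans (cong (λ z → fromℕ 20 * (z * fromℕ 3)) (sym (×ᵤ≈× semiring 4 1#)))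
      (trans (cong (fromℕ 20 *_) (sym (fromℕ-* 4 3))) (sym (fromℕ-* 20 12)))))

  -- Expected total time in terms of M and of 𝒪

  module _ {alg : Algorithm} (copies : Copies alg) {∇ o : ℝ}
    (argmin : Algorithm.IsArgminR alg ∇) (𝒪≡o : Algorithm.𝒪 alg ≡ [ o ]) where
    private
      module alg = Algorithm alg
      β = alg.ℙ[X≤ ∇ ]
      q = alg.ℙ[X> ∇ ]
      M = ∇ / β
    open Copies copies
    open Trials copies
    open Profile alg
    open Probability space
    open FirstSuccess (G ∇) (G-measurable ∇)
    private
      0≤β = ℙ-nonNeg-≤ ∇
      0≤M′ = 0≤M argmin 𝒪≡o
      1≤∇′ = 1≤∇ argmin 𝒪≡o
      Mβ≡∇ = M*β≡∇ argmin 𝒪≡o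

    T≤cost : ∀ l → 2# ^ l ≤ M → M ≤ 2# ^ suc l →
      ∀ k ω → G ∇ k ω → T ω ≤⁺ [ cost M (fromℕ l) (β * fromℕ (suc k)) ]
    T≤cost l 2^l≤M M≤2^[1+l] k ω A≤∇ with ceiling (proj₁ argmin)
    ... | n , ∇≤n , n≤1+∇ with terminates-by n (≤⁺-trans A≤∇ [ ∇≤n ])
    ...   | s , s<N , terminates = ≤⁺-trans (T-≤ terminates)
      [ cost-bounds-time (2^n>0 l) 2^l≤M M≤2^[1+l] (*-nonNeg 0≤β (fromℕ-nonNeg (suc k)))
          (fromℕ-nonNeg l) (fromℕ-nonNeg N) N≤ DW≤ ]
      where
      open ≤-Reasoning
      N = n ℕ.* suc k
      W = allotted k (suc s) ℕ.+ othersTime k s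
      N≤ : fromℕ N ≤ (2# * M) * (β * fromℕ (suc k))
      N≤ = begin
        fromℕ N                             ≡⟨ fromℕ-* n (suc k) ⟩
        fromℕ n * fromℕ (suc k)             ≤⟨ *-monoʳ-≤ (fromℕ-nonNeg (suc k)) (≤-trans n≤1+∇ (+-monoˡ-≤ ∇ 1≤∇′)) ⟩
        (∇ + ∇) * fromℕ (suc k)             ≡⟨ cong (λ x → (x + x) * fromℕ (suc k)) Mβ≡∇ ⟨
        (M * β + M * β) * fromℕ (suc k)     ≡⟨ solve 3 (λ M β κ → (M :* β :+ M :* β) :* κ := (con 2 :* M) :* (β :* κ)) refl M β (fromℕ (suc k)) ⟩
        (2# * M) * (β * fromℕ (suc k)) ∎
      DW≤ : 2# ^ l * fromℕ W ≤ 2# ^ l * (fromℕ N * fromℕ (suc l)) + fromℕ N * fromℕ N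
      DW≤ = begin
        2# ^ l * fromℕ W                    ≡⟨ cong (_* fromℕ W) (fromℕ-2^ l) ⟨
        fromℕ (2 ℕ.^ l) * fromℕ W           ≡⟨ fromℕ-* (2 ℕ.^ l) W ⟨
        fromℕ (2 ℕ.^ l ℕ.* W)               ≤⟨ fromℕ-mono-≤ (total-time-≤ l N k s s<N) ⟩
        fromℕ (2 ℕ.^ l ℕ.* (N ℕ.* suc l) ℕ.+ N ℕ.* N)  ≡⟨ fromℕ-+ (2 ℕ.^ l ℕ.* (N ℕ.* suc l)) (N ℕ.* N) ⟩
        fromℕ (2 ℕ.^ l ℕ.* (N ℕ.* suc l)) + fromℕ (N ℕ.* N)
          ≡⟨ cong₂ _+_ (trans (fromℕ-* (2 ℕ.^ l) (N ℕ.* suc l)) (cong₂ _*_ (fromℕ-2^ l) (fromℕ-* N (suc l)))) (fromℕ-* N N) ⟩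
        2# ^ l * (fromℕ N * fromℕ (suc l)) + fromℕ N * fromℕ N ∎

    𝔼T≤20Ml : ∀ l → 1 ℕ.≤ l → 2# ^ l ≤ M → M ≤ 2# ^ suc l → 𝔼 T ≤⁺ [ fromℕ 20 * (M * fromℕ l) ]
    𝔼T≤20Ml l 1≤l 2^l≤M M≤2^[1+l] = ≤⁺-trans
      (𝔼-≤-potential g h (alg.ℙ-nonNeg (alg.∁-measurable _ (≤-measurable ∇))) β+q≡1 (ℙ-NoneBefore ∇)
        (λ k → cost-nonNeg 0≤M′ 0≤ℓ (*-nonNeg 0≤β (fromℕ-nonNeg (suc k))))
        (λ k ω _ → T≤cost l 2^l≤M M≤2^[1+l] k ω) drift unbounded)
      [ subst (λ y → potential M (fromℕ l) 1# y ≤ fromℕ 20 * (M * fromℕ l)) (sym (zeroʳ β))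
          (potential-zero-≤ 0≤M′ (subst (_≤ fromℕ l) (+-identityʳ 1#) (fromℕ-mono-≤ 1≤l))) ]
      where
      0≤ℓ = fromℕ-nonNeg l
      β+q≡1 : β + q ≡ 1#
      β+q≡1 = Probability.ℙ-∁ alg.space (≤-measurable ∇)
      g h : ℕ → ℝ
      g k = cost M (fromℕ l) (β * fromℕ (suc k))
      h k = potential M (fromℕ l) 1# (β * fromℕ k)
      drift : ∀ k → β * g k + q * h (suc k) ≤ h k
      drift k = subst (λ x → β * cost M (fromℕ l) x + q * potential M (fromℕ l) 1# x ≤ h k)
        (trans (cong (_+ β * fromℕ k) (sym (*-identityʳ β))) (sym (distribˡ β 1# (fromℕ k))))
        (potential-drift (fromℕ l) (β * fromℕ k) 0≤M′ 0≤β β+q≡1)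
      unbounded : ∀ c → ∃[ k ] c ≤ h k
      unbounded c with archimedean c
      ... | k , c≤k = k , (begin
        c                    ≤⟨ c≤k ⟩
        fromℕ k              ≡⟨ *-identityˡ (fromℕ k) ⟨
        1# * fromℕ k         ≤⟨ *-monoʳ-≤ (fromℕ-nonNeg k) 1≤∇′ ⟩
        ∇ * fromℕ k          ≡⟨ cong (_* fromℕ k) Mβ≡∇ ⟨
        M * β * fromℕ k      ≡⟨ *-assoc M β (fromℕ k) ⟩
        M * (β * fromℕ k)    ≤⟨ M*y≤potential 0≤M′ 0≤ℓ (*-nonNeg 0≤β (fromℕ-nonNeg k)) ⟩
        h k ∎)
        where open ≤-Reasoning

    -- M and 𝒪 are compared on the exponents l and l′; each logarithm enters only through the lower
    -- bound given by its own exponent.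
    𝔼T-≤-dyadic : ∀ l l′ → 1 ℕ.≤ l → 2# ^ l ≤ M → M < 2# ^ suc l →
      1 ℕ.≤ l′ → 2# ^ l′ ≤ o → o < 2# ^ suc l′ →
      (𝔼 T ≤⁺ [ fromℕ 240 * (M * log M) ]) × (𝔼 T ≤⁺ [ fromℕ 240 * (o * log o) ])
    𝔼T-≤-dyadic l l′ 1≤l 2^l≤M M<2^[1+l] 1≤l′ 2^l′≤o o<2^[1+l′] =
      -- The first bound already holds with 20; it is raised to 240 to share the constant of the
      -- second.
      ≤⁺-trans 𝔼T≤ [ *-mono-≤ (fromℕ-nonNeg 20) (*-nonNeg 0≤M′ (≤-trans (fromℕ-nonNeg l) l≤log))
        (fromℕ-mono-≤ 20≤240) (*-monoˡ-≤ 0≤M′ l≤log) ] ,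
      ≤⁺-trans 𝔼T≤ [ (begin
        fromℕ 20 * (M * fromℕ l)              ≤⟨ *-monoˡ-≤ (fromℕ-nonNeg 20)
          (*-mono-≤ 0≤M′ (*-nonNeg (fromℕ-nonNeg 3) 0≤log) (M≤4𝒪 argmin 𝒪≡o) l≤3log) ⟩
        fromℕ 20 * (4# * o * (fromℕ 3 * log o)) ≡⟨ 20*4*3≡240 o (log o) ⟩
        fromℕ 240 * (o * log o) ∎) ]
      where
      open ≤-Reasoning
      𝔼T≤ = 𝔼T≤20Ml l 1≤l 2^l≤M (proj₁ M<2^[1+l])
      l≤log = ≤-log l (suc l) 2^l≤M (proj₁ M<2^[1+l])
      l′≤log = ≤-log l′ (suc l′) 2^l′≤o (proj₁ o<2^[1+l′])
      0≤log = ≤-trans (fromℕ-nonNeg l′) l′≤log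
      20≤240 : 20 ℕ.≤ 240
      20≤240 = ℕₚ.m≤m+n 20 220
      -- 2 ^ l ≤ M ≤ 4𝒪 < 4 · 2 ^ (1 + l′) = 2 ^ (3 + l′). Then l ≤ l′ + 2 ≤ 3 l′, because l′ ≥ 1.
      l<3+l′ : l ℕ.< 3 ℕ.+ l′
      l<3+l′ = 2^-cancel-< l (3 ℕ.+ l′) (≤-<-trans 2^l≤M (≤-<-trans (M≤4𝒪 argmin 𝒪≡o)
        (subst (4# * o <_) (solve 1 (λ x → con 4 :* (con 2 :* x) := con 2 :* (con 2 :* (con 2 :* x))) refl (2# ^ l′))
          (*-monoˡ-< 0<4 o<2^[1+l′]))))
      l≤3l′ : l ℕ.≤ 3 ℕ.* l′
      l≤3l′ = ℕₚ.≤-trans (s≤s⁻¹ l<3+l′) (ℕₚ.≤-trans (ℕₚ.≤-reflexive (ℕₚ.+-comm 2 l′))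
        (ℕₚ.+-monoʳ-≤ l′ (ℕₚ.*-monoʳ-≤ 2 1≤l′)))
      l≤3log : fromℕ l ≤ fromℕ 3 * log o
      l≤3log = ≤-trans (fromℕ-mono-≤ l≤3l′) (≤-trans (≤-reflexive (fromℕ-* 3 l′))
        (*-monoˡ-≤ (fromℕ-nonNeg 3) l′≤log))

    𝔼T-≤ : 2# ≤ o →
      (𝔼 T ≤⁺ [ fromℕ 240 * (M * log M) ]) × (𝔼 T ≤⁺ [ fromℕ 240 * (o * log o) ])
    𝔼T-≤ 2≤o =
      let l  , 1≤l  , 2^l≤M  , M<2^[1+l]  = dyadic-bracket (≤-trans 2≤o (𝒪≤M argmin 𝒪≡o))
          l′ , 1≤l′ , 2^l′≤o , o<2^[1+l′] = dyadic-bracket 2≤o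
      in 𝔼T-≤-dyadic l l′ 1≤l 2^l≤M M<2^[1+l] 1≤l′ 2^l′≤o o<2^[1+l′]

lemma3p4 :
  (em : ∀ {ℓ : Level} → ExcludedMiddle ℓ) (reals : Reals) →
  let open Reals reals
      open Theory em reals
  in
  ∃[ C ] (0# < C) ×
    (∀ (alg : Algorithm) (copies : Copies alg) (∇ 𝒪 : ℝ) →
      let β   = Algorithm.ℙ[X≤_] alg ∇
          𝔼[T] = Copies.𝔼 copies (Copies.T copies)
      in
      Algorithm.IsArgminR alg ∇ →
      Algorithm.𝒪 alg ≡ [ 𝒪 ] →
      1# + 1# ≤ 𝒪 →
      (𝔼[T] ≤⁺ [ C * ((∇ / β) * log (∇ / β)) ]) ×
      (𝔼[T] ≤⁺ [ C * (𝒪 * log 𝒪) ]))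
lemma3p4 em reals = fromℕ 240 , fromℕ-pos 239 , λ _ copies _ _ → 𝔼T-≤ copies
  where
  open Reals reals
  open WideSearch em reals
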